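{- For every integer $k\ge 0$, the number $a(2k+1)$ of near-perfect matchings of the $(2k+1)\times(2k+1)$ grid graph is an odd multiple of $2^k$, i.e. $a(2k+1)=2^k c_k$ with $c_k$ odd.
   Context: The $m\times n$ grid graph has vertex set $\{1,\dots,m\}\times\{1,\dots,n\}$, with two vertices adjacent when they differ by $1$ in exactly one coordinate. For a graph with an odd number of vertices, a near-perfect matching is a set of pairwise disjoint edges covering all vertices but one. -}

module Defs where

open import Data.Nat using (ℕ; zero; suc; _+_; _*_; _∸_; _≡ᵇ_; _≤ᵇ_)
open import Data.Bool using (Bool; true; false; _∧_; _∨_)
open import Data.List using (List; []; _∷_; map; concatMap; filterᵇ; length; upTo; _++_)
open import Data.Product using (_×_; _,_; ∃)
open import Relation.Binary.PropositionalEquality using (_≡_)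

-- Vertices are pairs of natural numbers; edges are unordered pairs,
-- represented by one orientation (each edge is listed exactly once).
Vertex : Set
Vertex = ℕ × ℕ

Edge : Set
Edge = Vertex × Vertex

range : ℕ → List ℕ
range n = map suc (upTo n)

gridVertices : ℕ → ℕ → List Vertex
gridVertices m n = concatMap (λ i → map (λ j → (i , j)) (range n)) (range m)

gridEdges : ℕ → ℕ → List Edge
gridEdges m n =
  concatMap (λ i → map (λ j → ((i , j) , (i , suc j))) (range (n ∸ 1))) (range m)
  ++ concatMap (λ i → map (λ j → ((i , j) , (suc i , j))) (range n)) (range (m ∸ 1))

_==ᵥ_ : Vertex → Vertex → Bool
(a , b) ==ᵥ (c , d) = (a ≡ᵇ c) ∧ (b ≡ᵇ d)

incident : Vertex → Edge → Bool
incident v (u , w) = (v ==ᵥ u) ∨ (v ==ᵥ w)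

allᵇ : {A : Set} → (A → Bool) → List A → Bool
allᵇ p [] = true
allᵇ p (x ∷ xs) = p x ∧ allᵇ p xs

degreeIn : List Edge → Vertex → ℕ
degreeIn M v = length (filterᵇ (incident v) M)

subsets : {A : Set} → List A → List (List A)
subsets [] = [] ∷ []
subsets (x ∷ xs) = let s = subsets xs in s ++ map (x ∷_) s

isNearPerfectMatching : List Vertex → List Edge → Bool
isNearPerfectMatching V M =
  allᵇ (λ v → degreeIn M v ≤ᵇ 1) V
  ∧ (length (filterᵇ (λ v → degreeIn M v ≡ᵇ 0) V) ≡ᵇ 1)

nearPerfectMatchings : ℕ → ℕ → ℕ
nearPerfectMatchings m n =
  length (filterᵇ (isNearPerfectMatching (gridVertices m n)) (subsets (gridEdges m n)))

a : ℕ → ℕ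
a n = nearPerfectMatchings n n

Odd : ℕ → Set
Odd c = ∃ λ t → c ≡ suc (2 * t)

{-# OPTIONS --safe #-}

-- Colour (i , j) black when i + j is odd. There is one more white than black vertex, so a near-perfect matching
-- is an injective choice of a white neighbour for every black vertex. Folding the grid along the main diagonal
-- (reflection σ) puts the choices of b and σ b on a single triangle, labelled X and Y, and the number of matchings
-- becomes a sum over all choices of a product of weights, one for each white vertex of the triangle, depending only
-- on the labels received there. Introduce a label Z = (Y − X) / 2 by multilinearity. A label X received twice has
-- weight 0, so the sum over the choices (X at p, Y at q) of b is twice the sum over the choices (X at p, Z at q)
-- and the choices (X at p, X at q) with p before q. This gives a factor 2 for each black vertex b of the triangle,
-- of which all but k are used up by the factor 2 put into the weights of the off-diagonal white vertices.
--
-- The remaining sum is odd: modulo 2 only the states symmetric under the reflection τ in the other diagonal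
-- count, and exactly one of these has odd weight, namely the one in which every black vertex of the quarter
-- below that diagonal puts X on its left and Z on its right neighbour.

module Submission where

open import Defs
open import Data.Bool using (Bool; true; false; not; _∧_; _∨_; _xor_; if_then_else_; T)
import Data.Bool.Properties as Bool
open import Data.Empty using (⊥; ⊥-elim)
open import Data.Integer as ℤ using (ℤ; 0ℤ; 1ℤ; _+_; _*_; -_; _-_)
import Data.Integer.Properties as ℤ
open import Data.Integer.Tactic.RingSolver using (solve-∀)
open import Data.List using (List; []; _∷_; [_]; map; concatMap; filterᵇ; length; _++_; cartesianProduct; cartesianProductWith; replicate)
import Data.List.Properties as List
open import Data.List.Membership.Propositional using (_∈_; _∉_)
import Data.List.Membership.Propositional.Properties as ∈
open import Data.List.Relation.Binary.Permutation.Propositional as ↭ using (_↭_; ↭-trans; ↭-refl; ↭-reflexive; prep; swap)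
import Data.List.Relation.Binary.Permutation.Propositional.Properties as ↭
open import Data.List.Relation.Unary.All as All using (All; []; _∷_)
import Data.List.Relation.Unary.All.Properties as All
open import Data.List.Relation.Unary.AllPairs as AllPairs using (AllPairs; []; _∷_)
import Data.List.Relation.Unary.AllPairs.Properties as AllPairs
open import Data.List.Relation.Unary.Any using (here; there)
open import Data.List.Relation.Unary.Unique.Propositional using (Unique)
import Data.List.Relation.Unary.Unique.Propositional.Properties as Unique
open import Data.List.Relation.Binary.BagAndSetEquality using (∼bag⇒↭)
open import Data.List.Membership.Propositional.Properties.WithK using (unique∧set⇒bag)
open import Data.Nat as ℕ using (ℕ; zero; suc; _∸_; _≤_; _<_; z≤n; s≤s; _≡ᵇ_; _≤ᵇ_; _<ᵇ_)
import Data.Nat.Properties as ℕ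
open import Data.Nat.ListAction using (sum)
import Data.Nat.Tactic.RingSolver as ℕS
open import Data.Product using (_×_; _,_; proj₁; proj₂; ∃)
open import Data.Sum using (_⊎_; inj₁; inj₂)
open import Function using (_∘_; mk⇔)
open import Relation.Binary.PropositionalEquality using (_≡_; _≢_; refl; sym; trans; cong; cong₂; subst; module ≡-Reasoning)
open import Relation.Nullary using (¬_; yes; no; T?)

-- Why the off-diagonal weights are doubled: Y = X + 2 Z makes the weight at X, Z half of the weight
-- at X, Y, so with weights 0 and 1 the label Z would bring in halves. Doubling keeps every weight
-- integral. It costs one factor 2 for each of the k^2 off-diagonal white vertices of the triangle,
-- while its k(k+1) black vertices gain one factor each. On the diagonal no halves arise: two labels
-- weigh 0, and a single X weighs the same as a single Y. Some weights are negative, so all sums are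
-- taken in the integers.
--
-- Two facts modulo 2 lead to the unique odd state. An off-diagonal vertex without a Z has even
-- weight. A white vertex on the other diagonal is fixed by τ and receives every label twice in a
-- symmetric state, which modulo 2 has the same weight as receiving it once together with an extra
-- X. These extra X are the initial data of a sweep towards the main diagonal: at each black vertex
-- a second X on an occupied neighbour is excluded, and the Z is claimed by a vertex that no later
-- step can serve.

private
  variable
    A B C : Set

-- Sums and products over lists, and sums over systems of choices.

∑ : List A → (A → ℤ) → ℤ
∑ []       f = 0ℤ
∑ (x ∷ xs) f = f x + ∑ xs f

∏ : List A → (A → ℤ) → ℤ
∏ []       f = 1ℤ
∏ (x ∷ xs) f = f x * ∏ xs f

∑-cong : (xs : List A) {f g : A → ℤ} → (∀ {x} → x ∈ xs → f x ≡ g x) → ∑ xs f ≡ ∑ xs g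
∑-cong []       eq = refl
∑-cong (x ∷ xs) eq = cong₂ _+_ (eq (here refl)) (∑-cong xs (eq ∘ there))

∏-cong : (xs : List A) {f g : A → ℤ} → (∀ {x} → x ∈ xs → f x ≡ g x) → ∏ xs f ≡ ∏ xs g
∏-cong []       eq = refl
∏-cong (x ∷ xs) eq = cong₂ _*_ (eq (here refl)) (∏-cong xs (eq ∘ there))

∑-++ : (xs ys : List A) {f : A → ℤ} → ∑ (xs ++ ys) f ≡ ∑ xs f + ∑ ys f
∑-++ []       ys     = sym (ℤ.+-identityˡ _)
∑-++ (x ∷ xs) ys {f} = trans (cong (f x +_) (∑-++ xs ys)) (sym (ℤ.+-assoc (f x) _ _))

∏-++ : (xs ys : List A) {f : A → ℤ} → ∏ (xs ++ ys) f ≡ ∏ xs f * ∏ ys f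
∏-++ []       ys     = sym (ℤ.*-identityˡ _)
∏-++ (x ∷ xs) ys {f} = trans (cong (f x *_) (∏-++ xs ys)) (sym (ℤ.*-assoc (f x) _ _))

∑-map : (g : A → B) (xs : List A) {f : B → ℤ} → ∑ (map g xs) f ≡ ∑ xs (f ∘ g)
∑-map g []           = refl
∑-map g (x ∷ xs) {f} = cong (f (g x) +_) (∑-map g xs)

∏-map : (g : A → B) (xs : List A) {f : B → ℤ} → ∏ (map g xs) f ≡ ∏ xs (f ∘ g)
∏-map g []           = refl
∏-map g (x ∷ xs) {f} = cong (f (g x) *_) (∏-map g xs)

∑-↭ : {xs ys : List A} (f : A → ℤ) → xs ↭ ys → ∑ xs f ≡ ∑ ys f
∑-↭ f ↭.refl        = refl
∑-↭ f (prep x p)    = cong (f x +_) (∑-↭ f p)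
∑-↭ f (swap x y p)  = trans (lemma (f x) (f y) _) (cong (λ s → f y + (f x + s)) (∑-↭ f p))
  where
  lemma : ∀ a b c → a + (b + c) ≡ b + (a + c)
  lemma = solve-∀
∑-↭ f (↭.trans p q) = trans (∑-↭ f p) (∑-↭ f q)

∏-↭ : {xs ys : List A} (f : A → ℤ) → xs ↭ ys → ∏ xs f ≡ ∏ ys f
∏-↭ f ↭.refl        = refl
∏-↭ f (prep x p)    = cong (f x *_) (∏-↭ f p)
∏-↭ f (swap x y p)  = trans (lemma (f x) (f y) _) (cong (λ s → f y * (f x * s)) (∏-↭ f p))
  where
  lemma : ∀ a b c → a * (b * c) ≡ b * (a * c)
  lemma = solve-∀
∏-↭ f (↭.trans p q) = trans (∏-↭ f p) (∏-↭ f q)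

∑-zero : (xs : List A) → ∑ xs (λ _ → 0ℤ) ≡ 0ℤ
∑-zero []       = refl
∑-zero (x ∷ xs) = trans (ℤ.+-identityˡ _) (∑-zero xs)

∑-+ : (xs : List A) {f g : A → ℤ} → ∑ xs (λ x → f x + g x) ≡ ∑ xs f + ∑ xs g
∑-+ []               = refl
∑-+ (x ∷ xs) {f} {g} = trans (cong (f x + g x +_) (∑-+ xs)) (lemma (f x) (g x) _ _)
  where
  lemma : ∀ a b c d → a + b + (c + d) ≡ a + c + (b + d)
  lemma = solve-∀

∏-* : (xs : List A) {f g : A → ℤ} → ∏ xs (λ x → f x * g x) ≡ ∏ xs f * ∏ xs g
∏-* []               = refl
∏-* (x ∷ xs) {f} {g} = trans (cong (f x * g x *_) (∏-* xs)) (lemma (f x) (g x) _ _)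
  where
  lemma : ∀ a b c d → a * b * (c * d) ≡ a * c * (b * d)
  lemma = solve-∀

*-∑ : ∀ c (xs : List A) {f : A → ℤ} → c * ∑ xs f ≡ ∑ xs (λ x → c * f x)
*-∑ c []           = ℤ.*-zeroʳ c
*-∑ c (x ∷ xs) {f} = trans (ℤ.*-distribˡ-+ c (f x) _) (cong (c * f x +_) (*-∑ c xs))

∑-swap : (xs : List A) (ys : List B) {f : A → B → ℤ} →
         ∑ xs (λ x → ∑ ys (f x)) ≡ ∑ ys (λ y → ∑ xs (λ x → f x y))
∑-swap []       ys     = sym (∑-zero ys)
∑-swap (x ∷ xs) ys {f} = trans (cong (∑ ys (f x) +_) (∑-swap xs ys)) (sym (∑-+ ys))

-- The sum of w over all concatenations c₁ ++ … ++ cₙ with one choice cᵢ from each list of Cs.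
S : List (List (List A)) → (List A → ℤ) → ℤ
S []       w = w []
S (C ∷ Cs) w = ∑ C (λ c → S Cs (λ l → w (c ++ l)))

Symmetric : (List A → ℤ) → Set
Symmetric w = ∀ {l l′} → l ↭ l′ → w l ≡ w l′

AllChoices : (A → Set) → List (List (List A)) → Set
AllChoices P = All (All (All P))

-- The geometric identities between weights hold only for picks inside a given vertex set; `P`
-- carries this restriction through the sum.
S-cong-All : {P : A → Set} {Cs : List (List (List A))} {w w′ : List A → ℤ} →
             AllChoices P Cs → (∀ l → All P l → w l ≡ w′ l) → S Cs w ≡ S Cs w′
S-cong-All {Cs = []}     []       eq = eq [] []
S-cong-All {Cs = C ∷ Cs} (p ∷ ps) eq =
  ∑-cong C (λ {c} c∈C → S-cong-All ps (λ l pl → eq (c ++ l) (All.++⁺ (All.lookup p c∈C) pl)))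

S-cong : (Cs : List (List (List A))) {w w′ : List A → ℤ} → (∀ l → w l ≡ w′ l) → S Cs w ≡ S Cs w′
S-cong []       eq = eq []
S-cong (C ∷ Cs) eq = ∑-cong C (λ {c} _ → S-cong Cs (λ l → eq (c ++ l)))

S-++ : (Cs Ds : List (List (List A))) {w : List A → ℤ} →
       S (Cs ++ Ds) w ≡ S Cs (λ c → S Ds (λ d → w (c ++ d)))
S-++ []       Ds     = refl
S-++ (C ∷ Cs) Ds {w} = ∑-cong C (λ {c} _ → trans (S-++ Cs Ds)
  (S-cong Cs (λ l → S-cong Ds (λ d → cong w (sym (List.++-assoc c l d))))))

S-map : (f : A → B) (Cs : List (List (List A))) {w : List B → ℤ} →
        S (map (map (map f)) Cs) w ≡ S Cs (w ∘ map f)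
S-map f []           = refl
S-map f (C ∷ Cs) {w} = trans (∑-map (map f) C) (∑-cong C (λ {c} _ → trans (S-map f Cs)
  (S-cong Cs (λ l → cong w (sym (List.map-++ f c l))))))

*-S : ∀ c (Cs : List (List (List A))) {w : List A → ℤ} → c * S Cs w ≡ S Cs (λ l → c * w l)
*-S c []       = refl
*-S c (C ∷ Cs) = trans (*-∑ c C) (∑-cong C (λ _ → *-S c Cs))

S-zero : (Cs : List (List (List A))) → S Cs (λ _ → 0ℤ) ≡ 0ℤ
S-zero []       = refl
S-zero (C ∷ Cs) = trans (∑-cong C (λ _ → S-zero Cs)) (∑-zero C)

S-∑ : (Cs : List (List (List A))) (ys : List B) {w : List A → B → ℤ} →
      S Cs (λ l → ∑ ys (w l)) ≡ ∑ ys (λ y → S Cs (λ l → w l y))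
S-∑ []       ys = refl
S-∑ (C ∷ Cs) ys = trans (∑-cong C (λ _ → S-∑ Cs ys)) (∑-swap C ys)

S-swap : (Cs : List (List (List A))) (Ds : List (List (List B))) {w : List A → List B → ℤ} →
         S Cs (λ c → S Ds (w c)) ≡ S Ds (λ d → S Cs (λ c → w c d))
S-swap Cs []       = refl
S-swap Cs (D ∷ Ds) = trans (S-∑ Cs D) (∑-cong D (λ _ → S-swap Cs Ds))

Symmetric-++ : {w : List A → ℤ} → Symmetric w → ∀ c → Symmetric (λ l → w (c ++ l))
Symmetric-++ sw c p = sw (↭.++⁺ˡ c p)

-- Exchanging two lists of options exchanges two blocks in the argument of `w`, which is harmless
-- only for a symmetric `w`.
S-↭ : {Cs Ds : List (List (List A))} {w : List A → ℤ} → Symmetric w → Cs ↭ Ds → S Cs w ≡ S Ds w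
S-↭ sw ↭.refl        = refl
S-↭ sw (prep C p)    = ∑-cong C (λ {c} _ → S-↭ (Symmetric-++ sw c) p)
S-↭ sw (swap {Cs} {Ds} C D p) = trans (∑-swap C D)
  (∑-cong D (λ {d} _ → ∑-cong C (λ {c} _ → trans
    (S-cong Cs (λ l → sw (↭.shifts c d)))
    (S-↭ (Symmetric-++ (Symmetric-++ sw d) c) p))))
S-↭ sw (↭.trans p q) = trans (S-↭ sw p) (S-↭ sw q)

-- Congruence modulo 2, and symmetric double sums.

infix 4 _≈₂_

record _≈₂_ (x y : ℤ) : Set where
  constructor half
  field
    {h}  : ℤ
    x≡y+2h : x ≡ y + (h + h)

≈₂-reflexive : ∀ {x y} → x ≡ y → x ≈₂ y
≈₂-reflexive {x} refl = half {h = 0ℤ} (sym (ℤ.+-identityʳ x))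

≈₂-trans : ∀ {x y z} → x ≈₂ y → y ≈₂ z → x ≈₂ z
≈₂-trans {z = z} (half {s} refl) (half {t} refl) = half {h = t + s} (lemma z s t)
  where
  lemma : ∀ z s t → z + (t + t) + (s + s) ≡ z + (t + s + (t + s))
  lemma = solve-∀

≈₂-sym : ∀ {x y} → x ≈₂ y → y ≈₂ x
≈₂-sym {y = y} (half {t} refl) = half {h = - t} (lemma y t)
  where
  lemma : ∀ y t → y ≡ y + (t + t) + (- t + - t)
  lemma = solve-∀

+-cong-≈₂ : ∀ {x x′ y y′} → x ≈₂ x′ → y ≈₂ y′ → x + y ≈₂ x′ + y′
+-cong-≈₂ {x′ = x} {y′ = y} (half {s} refl) (half {t} refl) = half {h = s + t} (lemma x y s t)
  where
  lemma : ∀ x y s t → x + (s + s) + (y + (t + t)) ≡ x + y + (s + t + (s + t))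
  lemma = solve-∀

*-cong-≈₂ : ∀ {x x′ y y′} → x ≈₂ x′ → y ≈₂ y′ → x * y ≈₂ x′ * y′
*-cong-≈₂ {x′ = x} {y′ = y} (half {s} refl) (half {t} refl) = half {h = s * y + x * t + (s * t + s * t)} (lemma x y s t)
  where
  lemma : ∀ x y s t → (x + (s + s)) * (y + (t + t)) ≡
          x * y + (s * y + x * t + (s * t + s * t) + (s * y + x * t + (s * t + s * t)))
  lemma = solve-∀

∑-cong-≈₂ : (xs : List A) {f g : A → ℤ} → (∀ {x} → x ∈ xs → f x ≈₂ g x) → ∑ xs f ≈₂ ∑ xs g
∑-cong-≈₂ []       eq = ≈₂-reflexive refl
∑-cong-≈₂ (x ∷ xs) eq = +-cong-≈₂ (eq (here refl)) (∑-cong-≈₂ xs (eq ∘ there))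

∏-cong-≈₂ : (xs : List A) {f g : A → ℤ} → (∀ {x} → x ∈ xs → f x ≈₂ g x) → ∏ xs f ≈₂ ∏ xs g
∏-cong-≈₂ []       eq = ≈₂-reflexive refl
∏-cong-≈₂ (x ∷ xs) eq = *-cong-≈₂ (eq (here refl)) (∏-cong-≈₂ xs (eq ∘ there))

∑-even : (xs : List A) {f : A → ℤ} → (∀ {x} → x ∈ xs → f x ≈₂ 0ℤ) → ∑ xs f ≈₂ 0ℤ
∑-even xs ev = ≈₂-trans (∑-cong-≈₂ xs ev) (≈₂-reflexive (∑-zero xs))

∏-even : (xs : List A) {f : A → ℤ} {x : A} → x ∈ xs → f x ≈₂ 0ℤ → ∏ xs f ≈₂ 0ℤ
∏-even (x ∷ xs) {f} (here refl) ev = ≈₂-trans (*-cong-≈₂ ev (≈₂-reflexive {∏ xs f} refl)) (≈₂-reflexive (ℤ.*-zeroˡ (∏ xs f)))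
∏-even (x ∷ xs) {f} (there x∈)  ev = ≈₂-trans (*-cong-≈₂ (≈₂-reflexive {f x} refl) (∏-even xs x∈ ev)) (≈₂-reflexive (ℤ.*-zeroʳ (f x)))

S-cong-≈₂ : {P : A → Set} {Cs : List (List (List A))} {w w′ : List A → ℤ} →
            AllChoices P Cs → (∀ l → All P l → w l ≈₂ w′ l) → S Cs w ≈₂ S Cs w′
S-cong-≈₂ {Cs = []}     []       eq = eq [] []
S-cong-≈₂ {Cs = C ∷ Cs} (p ∷ ps) eq =
  ∑-cong-≈₂ C (λ {c} c∈C → S-cong-≈₂ ps (λ l pl → eq (c ++ l) (All.++⁺ (All.lookup p c∈C) pl)))

pairs : List A → List (A × A)
pairs []       = []
pairs (x ∷ xs) = map (x ,_) xs ++ pairs xs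

-- The terms `h x y` and `h y x` are paired by position in the list, so repeated entries are
-- harmless. The exact form is kept because the change of labels extracts a true factor 2 from it.
∑-square : (xs : List A) {h : A → A → ℤ} → (∀ {x y} → x ∈ xs → y ∈ xs → h x y ≡ h y x) →
           let s = ∑ (pairs xs) (λ (x , y) → h x y) in
           ∑ xs (λ x → ∑ xs (h x)) ≡ ∑ xs (λ x → h x x) + (s + s)
∑-square []           sh = refl
∑-square (x ∷ xs) {h} sh = begin
  h x x + ∑ xs (h x) + ∑ xs (λ y → h y x + ∑ xs (h y))
    ≡⟨ cong (λ s → h x x + ∑ xs (h x) + s) (∑-+ xs) ⟩
  h x x + ∑ xs (h x) + (∑ xs (λ y → h y x) + ∑ xs (λ y → ∑ xs (h y)))
    ≡⟨ cong₂ (λ s t → h x x + ∑ xs (h x) + (s + t))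
         (∑-cong xs (λ y∈ → sh (there y∈) (here refl))) (∑-square xs (λ p q → sh (there p) (there q))) ⟩
  h x x + ∑ xs (h x) + (∑ xs (h x) + (∑ xs (λ y → h y y) + (s + s)))
    ≡⟨ lemma (h x x) (∑ xs (h x)) _ s ⟩
  h x x + ∑ xs (λ y → h y y) + (∑ xs (h x) + s + (∑ xs (h x) + s))
    ≡⟨ cong (λ t → h x x + ∑ xs (λ y → h y y) + (t + t))
         (trans (cong (_+ s) (sym (∑-map (x ,_) xs))) (sym (∑-++ (map (x ,_) xs) (pairs xs)))) ⟩
  h x x + ∑ xs (λ y → h y y) + (∑ (pairs (x ∷ xs)) _ + ∑ (pairs (x ∷ xs)) _) ∎
  where
  open ≡-Reasoning
  s = ∑ (pairs xs) (λ (x , y) → h x y)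
  lemma : ∀ a b c d → a + b + (b + (c + (d + d))) ≡ a + c + (b + d + (b + d))
  lemma = solve-∀

∑-diagonal : (xs : List A) {h : A → A → ℤ} → (∀ {x y} → x ∈ xs → y ∈ xs → h x y ≡ h y x) →
             ∑ xs (λ x → ∑ xs (h x)) ≈₂ ∑ xs (λ x → h x x)
∑-diagonal xs {h} sh = half {h = ∑ (pairs xs) (λ (x , y) → h x y)} (∑-square xs sh)

-- The pairs (f , g) and (g , f) cancel modulo 2. The induction does this one list at a time: after
-- the inner sums are interchanged, the total is symmetric in the two first options `c` and `d`, so
-- only `c = d` remains.
S-diagonal : {P : A → Set} {Cs : List (List (List A))} {h : List A → List A → ℤ} → AllChoices P Cs →
             (∀ f g → All P f → All P g → h f g ≡ h g f) →
             S Cs (λ f → S Cs (h f)) ≈₂ S Cs (λ f → h f f)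
S-diagonal {Cs = []}     []       sh = ≈₂-reflexive refl
S-diagonal {P = P} {Cs = C ∷ Cs} {h} (p ∷ ps) sh = ≈₂-trans
  (≈₂-reflexive (∑-cong C (λ _ → S-∑ Cs C)))
  (≈₂-trans
    (∑-diagonal C (λ {c} {d} c∈ d∈ → trans (S-swap Cs Cs)
      (S-cong-All ps (λ f pf → S-cong-All ps (λ g pg →
        sh (c ++ g) (d ++ f) (All.++⁺ (All.lookup p c∈) pg) (All.++⁺ (All.lookup p d∈) pf))))))
    (∑-cong-≈₂ C (λ {c} c∈ → S-diagonal ps (λ f g pf pg →
        sh (c ++ f) (c ++ g) (All.++⁺ (All.lookup p c∈) pf) (All.++⁺ (All.lookup p c∈) pg)))))

-- Labels, picks, and the weight of a single white vertex.

==ᵥ-refl : ∀ v → (v ==ᵥ v) ≡ true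
==ᵥ-refl (i , j) = cong₂ _∧_ (≡ᵇ-refl i) (≡ᵇ-refl j)
  where
  ≡ᵇ-refl : ∀ m → (m ≡ᵇ m) ≡ true
  ≡ᵇ-refl zero    = refl
  ≡ᵇ-refl (suc m) = ≡ᵇ-refl m

==ᵥ⇒≡ : ∀ u v → (u ==ᵥ v) ≡ true → u ≡ v
==ᵥ⇒≡ (a , b) (c , d) eq with a ≡ᵇ c in p | b ≡ᵇ d in q
... | true | true = cong₂ _,_ (ℕ.≡ᵇ⇒≡ a c (subst T (sym p) _)) (ℕ.≡ᵇ⇒≡ b d (subst T (sym q) _))

≢⇒==ᵥ : ∀ {u v} → u ≢ v → (u ==ᵥ v) ≡ false
≢⇒==ᵥ {u} {v} u≢v with u ==ᵥ v in eq
... | true  = ⊥-elim (u≢v (==ᵥ⇒≡ u v eq))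
... | false = refl

data Label : Set where
  X Y Z : Label

Pick : Set
Pick = Vertex × Label

at : Vertex → List Pick → List Label
at w []            = []
at w ((v , x) ∷ l) = if w ==ᵥ v then x ∷ at w l else at w l

at-self : ∀ w x l → at w ((w , x) ∷ l) ≡ x ∷ at w l
at-self w x l rewrite ==ᵥ-refl w = refl

at-other : ∀ {w v} x l → w ≢ v → at w ((v , x) ∷ l) ≡ at w l
at-other x l w≢v rewrite ≢⇒==ᵥ w≢v = refl

at-++ : ∀ w l l′ → at w (l ++ l′) ≡ at w l ++ at w l′
at-++ w []            l′ = refl
at-++ w ((v , x) ∷ l) l′ with w ==ᵥ v
... | true  = cong (x ∷_) (at-++ w l l′)
... | false = at-++ w l l′

at-↭ : ∀ w {l l′} → l ↭ l′ → at w l ↭ at w l′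
at-↭ w ↭.refl = ↭.refl
at-↭ w (prep (v , x) p) with w ==ᵥ v
... | true  = prep x (at-↭ w p)
... | false = at-↭ w p
at-↭ w (swap (u , x) (v , y) p) with w ==ᵥ u | w ==ᵥ v
... | true  | true  = swap x y (at-↭ w p)
... | true  | false = prep x (at-↭ w p)
... | false | true  = prep y (at-↭ w p)
... | false | false = at-↭ w p
at-↭ w (↭.trans p q) = ↭.trans (at-↭ w p) (at-↭ w q)

-- E true and E false are the weights of a white vertex on and off the diagonal. On lists of labels X and Y they are
-- 1 if there is at most one label, respectively 2 if X and Y both occur at most once, and 0 otherwise; the values
-- at lists containing Z are forced by Y = X + 2 Z.
E₁ : Label → ℤ
E₁ Z = 0ℤ
E₁ _ = ℤ.+ 2

E₂ : Label → Label → ℤ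
E₂ X Y = ℤ.+ 2
E₂ Y X = ℤ.+ 2
E₂ X Z = 1ℤ
E₂ Z X = 1ℤ
E₂ Y Z = - 1ℤ
E₂ Z Y = - 1ℤ
E₂ Z Z = - 1ℤ
E₂ X X = 0ℤ
E₂ Y Y = 0ℤ

D₁ : Label → ℤ
D₁ Z = 0ℤ
D₁ _ = 1ℤ

E : Bool → List Label → ℤ
E true  []              = 1ℤ
E true  (x ∷ [])        = D₁ x
E true  (_ ∷ _ ∷ _)     = 0ℤ
E false []              = ℤ.+ 2
E false (x ∷ [])        = E₁ x
E false (x ∷ y ∷ [])    = E₂ x y
E false (_ ∷ _ ∷ _ ∷ _) = 0ℤ

-- The prefix `k` lets the hypothesis reach transpositions deep inside the list; `go` moves the
-- entries already passed into it.
swap⇒Symmetric : {w : List A → ℤ} → (∀ k x y l → w (k ++ x ∷ y ∷ l) ≡ w (k ++ y ∷ x ∷ l)) → Symmetric w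
swap⇒Symmetric {A} {w} sw = go []
  where
  go : ∀ k {l l′} → l ↭ l′ → w (k ++ l) ≡ w (k ++ l′)
  go k ↭.refl                  = refl
  go k (prep {l} {l′} x p)     = trans (cong w (sym (List.++-assoc k [ x ] l)))
    (trans (go (k ++ [ x ]) p) (cong w (List.++-assoc k [ x ] l′)))
  go k (swap {l} {l′} x y p)   = trans (sw k x y l) (trans (cong w (sym (List.++-assoc k (y ∷ x ∷ []) l)))
    (trans (go (k ++ y ∷ x ∷ []) p) (cong w (List.++-assoc k (y ∷ x ∷ []) l′))))
  go k (↭.trans p q)           = trans (go k p) (go k q)

E₂-comm : ∀ x y → E₂ x y ≡ E₂ y x
E₂-comm X X = refl
E₂-comm X Y = refl
E₂-comm X Z = refl
E₂-comm Y X = refl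
E₂-comm Y Y = refl
E₂-comm Y Z = refl
E₂-comm Z X = refl
E₂-comm Z Y = refl
E₂-comm Z Z = refl

E-symmetric : ∀ b → Symmetric (E b)
E-symmetric true = swap⇒Symmetric λ where
  []          x y l → refl
  (_ ∷ [])    x y l → refl
  (_ ∷ _ ∷ _) x y l → refl
E-symmetric false = swap⇒Symmetric λ where
  []              x y []      → E₂-comm x y
  []              x y (_ ∷ _) → refl
  (_ ∷ [])        x y l       → refl
  (_ ∷ _ ∷ [])    x y l       → refl
  (_ ∷ _ ∷ _ ∷ _) x y l       → refl

E-Y : ∀ b l → E b (Y ∷ l) ≡ E b (X ∷ l) + (E b (Z ∷ l) + E b (Z ∷ l))
E-Y true  []          = refl
E-Y true  (_ ∷ _)     = refl
E-Y false []          = refl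
E-Y false (X ∷ [])    = refl
E-Y false (Y ∷ [])    = refl
E-Y false (Z ∷ [])    = refl
E-Y false (_ ∷ _ ∷ _) = refl

E-XX : ∀ b l → E b (X ∷ X ∷ l) ≡ 0ℤ
E-XX true  l       = refl
E-XX false []      = refl
E-XX false (_ ∷ _) = refl

-- Multilinearity of the weight and the change of labels.

∏-zero : (xs : List A) {f : A → ℤ} {x : A} → x ∈ xs → f x ≡ 0ℤ → ∏ xs f ≡ 0ℤ
∏-zero (x ∷ xs) {f} (here refl) eq = trans (cong (_* ∏ xs f) eq) (ℤ.*-zeroˡ (∏ xs f))
∏-zero (x ∷ xs) {f} (there x∈)  eq = trans (cong (f x *_) (∏-zero xs x∈ eq)) (ℤ.*-zeroʳ (f x))

-- `Unique xs` guarantees that only one factor changes; a repeated `q` would make the product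
-- nonlinear in that factor.
∏-linear : {xs : List A} {q : A} {f g h : A → ℤ} → Unique xs → q ∈ xs →
           (∀ {x} → x ≢ q → f x ≡ g x) → (∀ {x} → x ≢ q → f x ≡ h x) →
           f q ≡ g q + (h q + h q) → ∏ xs f ≡ ∏ xs g + (∏ xs h + ∏ xs h)
∏-linear {xs = _ ∷ xs} {q} {f} {g} {h} (q∉ ∷ u) (here refl) fg fh eq = begin
  f q * ∏ xs f
    ≡⟨ cong (_* ∏ xs f) eq ⟩
  (g q + (h q + h q)) * ∏ xs f
    ≡⟨ lemma (g q) (h q) (∏ xs f) ⟩
  g q * ∏ xs f + (h q * ∏ xs f + h q * ∏ xs f)
    ≡⟨ cong₂ (λ s t → g q * s + (h q * t + h q * t))
         (∏-cong xs (λ x∈ → fg (All.lookup q∉ x∈ ∘ sym))) (∏-cong xs (λ x∈ → fh (All.lookup q∉ x∈ ∘ sym))) ⟩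
  g q * ∏ xs g + (h q * ∏ xs h + h q * ∏ xs h) ∎
  where
  open ≡-Reasoning
  lemma : ∀ a b c → (a + (b + b)) * c ≡ a * c + (b * c + b * c)
  lemma = solve-∀
∏-linear {xs = x ∷ xs} {q} {f} {g} {h} (x∉ ∷ u) (there q∈) fg fh eq = begin
  f x * ∏ xs f
    ≡⟨ cong (f x *_) (∏-linear {f = f} {g} {h} u q∈ fg fh eq) ⟩
  f x * (∏ xs g + (∏ xs h + ∏ xs h))
    ≡⟨ lemma (f x) _ _ ⟩
  f x * ∏ xs g + (f x * ∏ xs h + f x * ∏ xs h)
    ≡⟨ cong₂ (λ s t → s * ∏ xs g + (t * ∏ xs h + t * ∏ xs h)) (fg x≢q) (fh x≢q) ⟩
  g x * ∏ xs g + (h x * ∏ xs h + h x * ∏ xs h) ∎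
  where
  open ≡-Reasoning
  x≢q = All.lookup x∉ q∈
  lemma : ∀ a b c → a * (b + (c + c)) ≡ a * b + (a * c + a * c)
  lemma = solve-∀

module Weight (diag : Vertex → Bool) where

  W : List Vertex → List Pick → ℤ
  W vs l = ∏ vs (λ v → E (diag v) (at v l))

  W-symmetric : ∀ vs → Symmetric (W vs)
  W-symmetric vs p = ∏-cong vs (λ {v} _ → E-symmetric (diag v) (at-↭ v p))

  W-Y : ∀ {vs q} l → Unique vs → q ∈ vs →
        W vs ((q , Y) ∷ l) ≡ W vs ((q , X) ∷ l) + (W vs ((q , Z) ∷ l) + W vs ((q , Z) ∷ l))
  W-Y {q = q} l u q∈ = ∏-linear u q∈ (other Y X) (other Y Z) (begin
    E (diag q) (at q ((q , Y) ∷ l))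
      ≡⟨ cong (E (diag q)) (at-self q Y l) ⟩
    E (diag q) (Y ∷ at q l)
      ≡⟨ E-Y (diag q) (at q l) ⟩
    E (diag q) (X ∷ at q l) + (E (diag q) (Z ∷ at q l) + E (diag q) (Z ∷ at q l))
      ≡⟨ cong₂ (λ k k′ → E (diag q) k + (E (diag q) k′ + E (diag q) k′)) (at-self q X l) (at-self q Z l) ⟨
    E (diag q) (at q ((q , X) ∷ l)) + (E (diag q) (at q ((q , Z) ∷ l)) + E (diag q) (at q ((q , Z) ∷ l))) ∎)
    where
    open ≡-Reasoning
    other : ∀ x y {v} → v ≢ q → E (diag v) (at v ((q , x) ∷ l)) ≡ E (diag v) (at v ((q , y) ∷ l))
    other x y {v} v≢q = cong (E (diag v)) (trans (at-other x l v≢q) (sym (at-other y l v≢q)))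

  W-XX : ∀ {vs p} l → p ∈ vs → W vs ((p , X) ∷ (p , X) ∷ l) ≡ 0ℤ
  W-XX {vs} {p} l p∈ = ∏-zero vs p∈ (trans
    (cong (E (diag p)) (trans (at-self p X ((p , X) ∷ l)) (cong (X ∷_) (at-self p X l))))
    (E-XX (diag p) (at p l)))

xz xx : A × A → List (A × Label)
xz (p , q) = (p , X) ∷ (q , Z) ∷ []
xx (p , q) = (p , X) ∷ (q , X) ∷ []

-- X and Z are distinguishable, so they take all ordered pairs of positions, equal ones included.
-- Two X take unordered pairs of different positions: this is half of a symmetric sum with zero
-- diagonal.
choices : List A → List (List (A × Label))
choices N = map xz (cartesianProduct N N) ++ map xx (pairs N)

∑-cartesianProduct : (xs : List A) (ys : List B) {f : A × B → ℤ} →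
                     ∑ (cartesianProduct xs ys) f ≡ ∑ xs (λ x → ∑ ys (λ y → f (x , y)))
∑-cartesianProduct []       ys     = refl
∑-cartesianProduct (x ∷ xs) ys {f} = trans (∑-++ (map (x ,_) ys) _)
  (cong₂ _+_ (∑-map (x ,_) ys) (∑-cartesianProduct xs ys))

-- The double sum in interleaved form: the two choices belonging to one list are made side by side,
-- so that the change of labels can act on one list at a time.
double : List (List A) → (List A → List A → ℤ) → ℤ
double []       w = w [] []
double (N ∷ Ns) w = ∑ N (λ p → ∑ N (λ q → double Ns (λ f g → w (p ∷ f) (q ∷ g))))

double-cong : (Ns : List (List A)) {w w′ : List A → List A → ℤ} → (∀ f g → w f g ≡ w′ f g) →
              double Ns w ≡ double Ns w′
double-cong []       eq = eq [] []
double-cong (N ∷ Ns) eq = ∑-cong N (λ {p} _ → ∑-cong N (λ {q} _ → double-cong Ns (λ f g → eq (p ∷ f) (q ∷ g))))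

S-S≡double : (Ns : List (List A)) {w : List A → List A → ℤ} → let Cs = map (map [_]) Ns in
             S Cs (λ f → S Cs (w f)) ≡ double Ns w
S-S≡double []           = refl
S-S≡double (N ∷ Ns) {w} = trans (∑-map [_] N) (∑-cong N (λ {p} _ → begin
  S Cs (λ f → ∑ (map [_] N) (λ c → S Cs (λ g → w (p ∷ f) (c ++ g))))
    ≡⟨ S-∑ Cs (map [_] N) ⟩
  ∑ (map [_] N) (λ c → S Cs (λ f → S Cs (λ g → w (p ∷ f) (c ++ g))))
    ≡⟨ ∑-map [_] N ⟩
  ∑ N (λ q → S Cs (λ f → S Cs (λ g → w (p ∷ f) (q ∷ g))))
    ≡⟨ ∑-cong N (λ _ → S-S≡double Ns) ⟩
  ∑ N (λ q → double Ns (λ f g → w (p ∷ f) (q ∷ g))) ∎))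
  where
  open ≡-Reasoning
  Cs = map (map [_]) Ns

module BaseChange (diag : Vertex → Bool) {vs : List Vertex} (u : Unique vs) where
  open Weight diag
  open ≡-Reasoning

  ∑-choices : ∀ {N} l → All (_∈ vs) N → let s = ∑ (choices N) (λ c → W vs (c ++ l)) in
              ∑ N (λ p → ∑ N (λ q → W vs ((p , X) ∷ (q , Y) ∷ l))) ≡ s + s
  ∑-choices {N} l N⊆ = begin
    ∑ N (λ p → ∑ N (λ q → W vs ((p , X) ∷ (q , Y) ∷ l)))
      ≡⟨ ∑-cong N (λ {p} _ → ∑-cong N (λ {q} q∈ → expand p q (All.lookup N⊆ q∈))) ⟩
    ∑ N (λ p → ∑ N (λ q → wxx p q + (wxz p q + wxz p q)))
      ≡⟨ trans (∑-cong N (λ {p} _ → split (wxx p) (wxz p)))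
               (split (λ p → ∑ N (wxx p)) (λ p → ∑ N (wxz p))) ⟩
    ∑ N (λ p → ∑ N (wxx p)) + (cross + cross)
      ≡⟨ cong (_+ (cross + cross)) (∑-square N (λ {p} {q} _ _ → W-symmetric vs (swap (p , X) (q , X) (↭-refl {x = l})))) ⟩
    ∑ N (λ p → wxx p p) + (s + s) + (cross + cross)
      ≡⟨ cong (λ d → d + (s + s) + (cross + cross))
           (trans (∑-cong N (λ {p} p∈ → W-XX l (All.lookup N⊆ p∈))) (∑-zero N)) ⟩
    0ℤ + (s + s) + (cross + cross)
      ≡⟨ lemma s cross ⟩
    cross + s + (cross + s)
      ≡⟨ cong (λ t → t + t) (sym (trans (∑-++ (map xz (cartesianProduct N N)) _) (cong₂ _+_
           (trans (∑-map xz (cartesianProduct N N)) (∑-cartesianProduct N N)) (∑-map xx (pairs N))))) ⟩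
    ∑ (choices N) (λ c → W vs (c ++ l)) + ∑ (choices N) (λ c → W vs (c ++ l)) ∎
    where
    wxx wxz : Vertex → Vertex → ℤ
    wxx p q = W vs ((p , X) ∷ (q , X) ∷ l)
    wxz p q = W vs ((p , X) ∷ (q , Z) ∷ l)
    cross = ∑ N (λ p → ∑ N (wxz p))
    s = ∑ (pairs N) (λ (p , q) → wxx p q)
    lemma : ∀ s c → 0ℤ + (s + s) + (c + c) ≡ c + s + (c + s)
    lemma = solve-∀
    split : (f g : Vertex → ℤ) → ∑ N (λ p → f p + (g p + g p)) ≡ ∑ N f + (∑ N g + ∑ N g)
    split f g = trans (∑-+ N) (cong (∑ N f +_) (∑-+ N))
    σ : ∀ p x q y → W vs ((p , x) ∷ (q , y) ∷ l) ≡ W vs ((q , y) ∷ (p , x) ∷ l)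
    σ p x q y = W-symmetric vs (swap (p , x) (q , y) (↭-refl {x = l}))
    expand : ∀ p q → q ∈ vs → W vs ((p , X) ∷ (q , Y) ∷ l) ≡ wxx p q + (wxz p q + wxz p q)
    expand p q q∈ = trans (σ p X q Y) (trans (W-Y ((p , X) ∷ l) u q∈)
      (cong₂ (λ s t → s + (t + t)) (σ q X p X) (σ q Z p X)))

  -- The accumulator `k` holds the X and Y picks of lists whose conversion is pending. The tail is
  -- converted around them first; then the sum over `p` and `q` moves inside, and `∑-choices`
  -- converts the head with one more factor 2.
  double≡S-choices : ∀ {Ns} k → All (All (_∈ vs)) Ns →
    double Ns (λ f g → W vs (map (_, X) f ++ map (_, Y) g ++ k)) ≡
    (ℤ.+ 2) ℤ.^ length Ns * S (map choices Ns) (λ l → W vs (l ++ k))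
  double≡S-choices             k []        = sym (ℤ.*-identityˡ _)
  double≡S-choices {N ∷ Ns} k (N⊆ ∷ Ns⊆) = begin
    ∑ N (λ p → ∑ N (λ q → double Ns (λ f g → W vs ((p , X) ∷ map (_, X) f ++ (q , Y) ∷ map (_, Y) g ++ k))))
      ≡⟨ ∑-cong N (λ {p} _ → ∑-cong N (λ {q} _ → trans
           (double-cong Ns (λ f g → W-symmetric vs (move (p , X) (q , Y) (map (_, X) f) (map (_, Y) g))))
           (double≡S-choices ((p , X) ∷ (q , Y) ∷ k) Ns⊆))) ⟩
    ∑ N (λ p → ∑ N (λ q → c * S Cs (λ l → W vs (l ++ (p , X) ∷ (q , Y) ∷ k))))
      ≡⟨ trans (∑-cong N (λ _ → sym (*-∑ c N))) (sym (*-∑ c N)) ⟩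
    c * ∑ N (λ p → ∑ N (λ q → S Cs (λ l → W vs (l ++ (p , X) ∷ (q , Y) ∷ k))))
      ≡⟨ cong (c *_) (trans (∑-cong N (λ _ → sym (S-∑ Cs N))) (sym (S-∑ Cs N))) ⟩
    c * S Cs (λ l → ∑ N (λ p → ∑ N (λ q → W vs (l ++ (p , X) ∷ (q , Y) ∷ k))))
      ≡⟨ cong (c *_) (S-cong Cs (λ l → trans
           (∑-cong N (λ {p} _ → ∑-cong N (λ {q} _ → W-symmetric vs (↭.shifts l ((p , X) ∷ (q , Y) ∷ [])))))
           (∑-choices (l ++ k) N⊆))) ⟩
    c * S Cs (λ l → D l + D l)
      ≡⟨ cong (c *_) (trans (S-cong Cs (λ l → double-ℤ (D l))) (sym (*-S (ℤ.+ 2) Cs))) ⟩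
    c * ((ℤ.+ 2) * S Cs D)
      ≡⟨ trans (lemma c (ℤ.+ 2) _) (cong (ℤ.+ 2 * c *_) (S-∑ Cs (choices N))) ⟩
    ℤ.+ 2 * c * ∑ (choices N) (λ x → S Cs (λ l → W vs (x ++ l ++ k)))
      ≡⟨ cong (ℤ.+ 2 * c *_) (∑-cong (choices N) (λ {x} _ →
           S-cong Cs (λ l → cong (W vs) (sym (List.++-assoc x l k))))) ⟩
    ℤ.+ 2 * c * ∑ (choices N) (λ x → S Cs (λ l → W vs ((x ++ l) ++ k))) ∎
    where
    c  = (ℤ.+ 2) ℤ.^ length Ns
    Cs = map choices Ns
    D : List Pick → ℤ
    D l = ∑ (choices N) (λ x → W vs (x ++ l ++ k))
    lemma : ∀ a b d → a * (b * d) ≡ b * a * d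
    lemma = solve-∀
    double-ℤ : ∀ t → t + t ≡ ℤ.+ 2 * t
    double-ℤ = solve-∀
    move : ∀ x y (f g : List Pick) → x ∷ f ++ y ∷ g ++ k ↭ f ++ g ++ x ∷ y ∷ k
    move x y f g = ↭-trans (prep x (↭-trans (↭.shift y f (g ++ k)) (prep y (↭-reflexive (sym (List.++-assoc f g k))))))
      (↭-trans (↭.shifts (x ∷ y ∷ []) (f ++ g)) (↭-reflexive (List.++-assoc f g _)))

-- Uniqueness modulo 2: the sweep over the quarter.

E-noZ : ∀ {l} → All (_≢ Z) l → E false l ≈₂ 0ℤ
E-noZ []                  = half {h = 1ℤ} refl
E-noZ {X ∷ []} (_ ∷ [])   = half {h = 1ℤ} refl
E-noZ {Y ∷ []} (_ ∷ [])   = half {h = 1ℤ} refl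
E-noZ {Z ∷ _} (z ∷ _)     = ⊥-elim (z refl)
E-noZ {_ ∷ Z ∷ _} (_ ∷ z ∷ _)  = ⊥-elim (z refl)
E-noZ {X ∷ X ∷ []} (_ ∷ _ ∷ []) = ≈₂-reflexive refl
E-noZ {X ∷ Y ∷ []} (_ ∷ _ ∷ []) = half {h = 1ℤ} refl
E-noZ {Y ∷ X ∷ []} (_ ∷ _ ∷ []) = half {h = 1ℤ} refl
E-noZ {Y ∷ Y ∷ []} (_ ∷ _ ∷ []) = ≈₂-reflexive refl
E-noZ {X ∷ X ∷ _ ∷ _} (_ ∷ _ ∷ _ ∷ _) = ≈₂-reflexive refl
E-noZ {X ∷ Y ∷ _ ∷ _} (_ ∷ _ ∷ _ ∷ _) = ≈₂-reflexive refl
E-noZ {Y ∷ X ∷ _ ∷ _} (_ ∷ _ ∷ _ ∷ _) = ≈₂-reflexive refl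
E-noZ {Y ∷ Y ∷ _ ∷ _} (_ ∷ _ ∷ _ ∷ _) = ≈₂-reflexive refl

at-All-≢ : ∀ {w x} {l : List Pick} → All (_≢ (w , x)) l → All (_≢ x) (at w l)
at-All-≢ []                                        = []
at-All-≢ {w} {x} {(v , y) ∷ _} (ne ∷ nes) with w ==ᵥ v in eq
... | false = at-All-≢ nes
... | true  = (λ y≡x → ne (cong₂ _,_ (sym (==ᵥ⇒≡ w v eq)) y≡x)) ∷ at-All-≢ nes

at-∉ : ∀ {w x vs} → w ∉ vs → at w (map (_, x) vs) ≡ []
at-∉ {vs = []}         w∉ = refl
at-∉ {w} {x} {v ∷ vs}  w∉ = trans (at-other x (map (_, x) vs) (w∉ ∘ here)) (at-∉ (w∉ ∘ there))

at-∈ : ∀ {w x vs} → Unique vs → w ∈ vs → at w (map (_, x) vs) ≡ [ x ]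
at-∈ {w} {x} {_ ∷ vs} (w∉ ∷ u) (here refl)   =
  trans (at-self w x (map (_, x) vs)) (cong (x ∷_) (at-∉ (λ w∈ → All.lookup w∉ w∈ refl)))
at-∈ {w} {x} {v ∷ vs} (v∉ ∷ u) (there w∈)    =
  trans (at-other x (map (_, x) vs) (λ { refl → All.lookup v∉ w∈ refl })) (at-∈ u w∈)

cartesianProduct-All : {P : A → Set} {Q : B → Set} {xs : List A} {ys : List B} → All P xs → All Q ys →
                       All (λ (x , y) → P x × Q y) (cartesianProduct xs ys)
cartesianProduct-All []       qs = []
cartesianProduct-All (p ∷ ps) qs = All.++⁺ (All.map⁺ (All.map (p ,_) qs)) (cartesianProduct-All ps qs)

pairs-All : {P : A → Set} {xs : List A} → All P xs → All (λ (x , y) → P x × P y) (pairs xs)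
pairs-All []       = []
pairs-All (p ∷ ps) = All.++⁺ (All.map⁺ (All.map (p ,_) ps)) (pairs-All ps)

choices-All : {P : A → Set} {N : List A} → All P N → All (All (P ∘ proj₁)) (choices N)
choices-All ps = All.++⁺ (All.map⁺ (All.map (λ (p , q) → p ∷ q ∷ []) (cartesianProduct-All ps ps)))
                         (All.map⁺ (All.map (λ (p , q) → p ∷ q ∷ []) (pairs-All ps)))

-- The white vertices of the triangle i ≤ j, i + j ≤ 2k + 2 are (i , i + 2d), the black ones (i , i + 2d + 1);
-- both are indexed by (i , d) below, with i ≥ 1 and i + d ≤ k + 1, respectively i + d ≤ k.

onDiagonal : Vertex → Bool
onDiagonal (i , d) = d ≡ᵇ 0

right : Vertex → Vertex
right (i , d) = i , suc d

up : Vertex → List Vertex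
up (suc (suc i) , d) = [ (suc i , suc d) ]
up _                 = []

downUp : Vertex → List Vertex
downUp (i , d) = (suc i , d) ∷ up (i , d)

-- The black vertex with index b has the white vertex with the same index b on its left; the other
-- entries are its right, lower and upper neighbours in white indices. Row 1 has no upper neighbour.
neighbours : Vertex → List Vertex
neighbours b = b ∷ right b ∷ downUp b

infix 4 _≻_

-- The order of the sweep, earlier vertices being larger: the lines of constant d are visited from
-- the far corner towards the main diagonal, and each line with decreasing i, starting next to the
-- other diagonal.
_≻_ : Vertex → Vertex → Set
(i , d) ≻ (j , e) = e < d ⊎ (d ≡ e × j < i)

≻-asym : ∀ {u v} → u ≻ v → ¬ v ≻ u
≻-asym (inj₁ p)          (inj₁ q)          = ℕ.<-asym p q
≻-asym (inj₁ p)          (inj₂ (refl , _)) = ℕ.<-irrefl refl p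
≻-asym (inj₂ (refl , _)) (inj₁ q)          = ℕ.<-irrefl refl q
≻-asym (inj₂ (_ , p))    (inj₂ (_ , q))    = ℕ.<-asym p q

≻⇒≢ : ∀ {u v} → u ≻ v → u ≢ v
≻⇒≢ p refl = ≻-asym p p

-- The reason for this order: each neighbour except the left one has an earlier index, so it lies on
-- the other diagonal or is the left neighbour of a black vertex already treated. Either way it
-- holds an X when b is reached.
neighbours-≻ : ∀ b → All (_≻ b) (right b ∷ downUp b)
neighbours-≻ (zero        , d) = inj₁ ℕ.≤-refl ∷ inj₂ (refl , ℕ.≤-refl) ∷ []
neighbours-≻ (suc zero    , d) = inj₁ ℕ.≤-refl ∷ inj₂ (refl , ℕ.≤-refl) ∷ []
neighbours-≻ (suc (suc i) , d) = inj₁ ℕ.≤-refl ∷ inj₂ (refl , ℕ.≤-refl) ∷ inj₁ ℕ.≤-refl ∷ []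

downUp-≢-right : ∀ b → All (_≢ right b) (downUp b)
downUp-≢-right (zero        , d) = (λ ()) ∷ []
downUp-≢-right (suc zero    , d) = (λ ()) ∷ []
downUp-≢-right (suc (suc i) , d) = (λ ()) ∷ (λ ()) ∷ []

-- With b = (i , d), the black vertices around `right b` have indices b, `right b`, (i - 1 , d + 1)
-- and (i + 1 , d), and b is the last of them in the sweep. A Z still missing there must therefore
-- come from b.
later-≢-right : ∀ b b′ → b ≻ b′ → All (_≢ right b) (neighbours b′)
later-≢-right b b′ b≻b′ = self b≻b′ ∷ rt b≻b′ ∷ down b≻b′ ∷ above b′ b≻b′
  where
  self : ∀ {b b′} → b ≻ b′ → b′ ≢ right b
  self (inj₁ p)          refl = ℕ.<-asym p ℕ.≤-refl
  self (inj₂ (() , _))   refl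
  rt : ∀ {b b′} → b ≻ b′ → right b′ ≢ right b
  rt p refl = ≻-asym p p
  down : ∀ {b i d} → b ≻ (i , d) → (suc i , d) ≢ right b
  down (inj₁ p)          refl = ℕ.<-asym p ℕ.≤-refl
  down (inj₂ (() , _))   refl
  above : ∀ {b} b′ → b ≻ b′ → All (_≢ right b) (up b′)
  above (zero        , _) p = []
  above (suc zero    , _) p = []
  above (suc (suc i) , d) (inj₁ p)       = (λ { refl → ℕ.<-irrefl refl p }) ∷ []
  above (suc (suc i) , d) (inj₂ (_ , p)) = (λ { refl → ℕ.<-asym p ℕ.≤-refl }) ∷ []

-- The hypothesis on the order in the form in which the induction of the sweep consumes it: `done`
-- collects the white vertices that hold an X, and each step adds the left neighbour of the black
-- vertex just treated.
data Ready (done : List Vertex) : List Vertex → Set where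
  []  : Ready done []
  _∷_ : ∀ {b bs} → All (_∈ done) (right b ∷ downUp b) × All (b ≻_) bs → Ready (b ∷ done) bs →
        Ready done (b ∷ bs)

ready : ∀ {done todo} → AllPairs _≻_ todo →
        (∀ {b} → b ∈ todo → All (λ q → q ∈ done ⊎ q ∈ todo) (right b ∷ downUp b)) → Ready done todo
ready {todo = []}     _        _ = []
ready {done} {b ∷ bs} (b≻ ∷ o) h =
  (All.zipWith (λ (p , q) → earlier p q) (neighbours-≻ b , h (here refl)) , b≻) ∷
  ready o (λ b′∈ → All.map shift (h (there b′∈)))
  where
  earlier : ∀ {q} → q ≻ b → q ∈ done ⊎ q ∈ b ∷ bs → q ∈ done
  earlier q≻b (inj₁ q∈)          = q∈
  earlier q≻b (inj₂ (here refl)) = ⊥-elim (≻-asym q≻b q≻b)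
  earlier q≻b (inj₂ (there q∈))  = ⊥-elim (≻-asym q≻b (All.lookup b≻ q∈))
  shift : ∀ {q} → q ∈ done ⊎ q ∈ b ∷ bs → q ∈ b ∷ done ⊎ q ∈ bs
  shift (inj₁ q∈)          = inj₁ (there q∈)
  shift (inj₂ (here refl)) = inj₁ (here refl)
  shift (inj₂ (there q∈))  = inj₂ q∈

forced : List Vertex → List Pick → List Pick
forced []       k = k
forced (b ∷ bs) k = forced bs ((b , X) ∷ (right b , Z) ∷ k)

module _ {vs : List Vertex} where
  open Weight onDiagonal

  W-double-X : ∀ {p k} c l → p ∈ vs → (p , X) ∈ k → (p , X) ∈ c → W vs (c ++ l ++ k) ≡ 0ℤ
  W-double-X {p} {k} c l p∈ p∈k p∈c with ∈.∈-∃++ p∈k | ∈.∈-∃++ p∈c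
  ... | k₁ , k₂ , refl | c₁ , c₂ , refl = trans
    (W-symmetric vs (↭-trans (↭.++⁺ (↭.shift (p , X) c₁ c₂)
        (↭-trans (↭.++⁺ˡ l (↭.shift (p , X) k₁ k₂)) (↭.shift (p , X) l (k₁ ++ k₂))))
      (↭.shift (p , X) ((p , X) ∷ c₁ ++ c₂) (l ++ k₁ ++ k₂))))
    (W-XX ((c₁ ++ c₂) ++ l ++ k₁ ++ k₂) p∈)

  W-no-Z : ∀ {b l} → right b ∈ vs → All (_≢ (right b , Z)) l → W vs l ≈₂ 0ℤ
  W-no-Z r∈ noZ = ∏-even vs r∈ (E-noZ (at-All-≢ noZ))

  -- Every neighbour of b except b itself already carries an X, so another X there gives a zero factor,
  -- while a Z is still needed at right b, which no later vertex can provide.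
  peel : ∀ {done todo} k → Ready done todo →
         (∀ {p} → p ∈ done → p ∈ vs × (p , X) ∈ k) →
         All (λ b → All (_≢ (right b , Z)) k × b ∈ vs) todo →
         S (map (choices ∘ neighbours) todo) (λ l → W vs (l ++ k)) ≈₂ W vs (forced todo k)
  peel                       k []                         doneX noZ = ≈₂-reflexive refl
  peel {done} {b ∷ bs} k ((N⊆ , b≻) ∷ rd) doneX ((noZb , b∈) ∷ noZ) =
    -- `choices (neighbours b)` computes to `xz (b , b) ∷ xz (b , r) ∷ rest`. Only the second option
    -- survives; the first one leaves `r` without a Z.
    ≈₂-trans (+-cong-≈₂ (even {xz (b , b)} (inj₂ ((λ ()) ∷ (λ ()) ∷ [])))
               (+-cong-≈₂ good (∑-even rest (λ c∈ → even (All.lookup bad c∈)))))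
    (≈₂-reflexive (trans (ℤ.+-identityˡ _) (ℤ.+-identityʳ _)))
    where
    r  = right b
    N′ = r ∷ downUp b
    Cs = map (choices ∘ neighbours) bs
    k′ = (b , X) ∷ (r , Z) ∷ k
    rest = map xz (map (b ,_) (downUp b) ++ cartesianProduct N′ (neighbours b)) ++ map xx (pairs (neighbours b))
    Bad : List Pick → Set
    Bad c = (∃ λ p → p ∈ done × (p , X) ∈ c) ⊎ All (_≢ (r , Z)) c
    bad : All Bad rest
    bad = All.++⁺ (All.map⁺ (All.++⁺
            (All.map⁺ (All.map (λ q≢r → inj₂ ((λ ()) ∷ (λ { refl → q≢r refl }) ∷ [])) (downUp-≢-right b)))
            (All.map (λ (p∈ , _) → inj₁ (_ , p∈ , here refl))
              (cartesianProduct-All {Q = λ v → v ≡ v} N⊆ (All.universal (λ _ → refl) (neighbours b))))))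
          (All.map⁺ (All.++⁺ (All.map⁺ (All.map (λ q∈ → inj₁ (_ , q∈ , there (here refl))) N⊆))
            (All.map (λ (p∈ , _) → inj₁ (_ , p∈ , here refl)) (pairs-All N⊆))))
    later : AllChoices (_≢ (r , Z)) Cs
    later = All.map⁺ (All.map (λ {b′} b≻b′ → All.map (All.map (λ q≢r → λ { refl → q≢r refl }))
                                (choices-All (later-≢-right b b′ b≻b′))) b≻)
    even : ∀ {c} → Bad c → S Cs (λ l → W vs ((c ++ l) ++ k)) ≈₂ 0ℤ
    even {c} (inj₁ (p , p∈ , pX)) = ≈₂-reflexive (trans
      (S-cong Cs (λ l → trans (cong (W vs) (List.++-assoc c l k))
        (W-double-X c l (proj₁ (doneX p∈)) (proj₂ (doneX p∈)) pX))) (S-zero Cs))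
    even {c} (inj₂ noZc) = ≈₂-trans
      (S-cong-≈₂ later (λ l noZl → W-no-Z {b} (proj₁ (doneX (All.head N⊆))) (All.++⁺ (All.++⁺ noZc noZl) noZb)))
      (≈₂-reflexive (S-zero Cs))
    good : S Cs (λ l → W vs ((xz (b , r) ++ l) ++ k)) ≈₂ W vs (forced bs k′)
    good = ≈₂-trans
      (≈₂-reflexive (S-cong Cs (λ l → W-symmetric vs (↭.shifts (xz (b , r)) l))))
      (peel k′ rd
        (λ { (here refl) → b∈ , here refl ; (there p∈) → proj₁ (doneX p∈) , there (there (proj₂ (doneX p∈))) })
        (All.zipWith (λ {b′} ((noZb′ , b′∈) , b≻b′) →
            ((λ ()) ∷ (λ e → All.head (All.tail (later-≢-right b b′ b≻b′)) (cong proj₁ (sym e))) ∷ noZb′) , b′∈)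
          (noZ , b≻)))

  forced-↭ : ∀ bs k → forced bs k ↭ map (_, X) bs ++ map (_, Z) (map right bs) ++ k
  forced-↭ []       k = ↭-refl
  forced-↭ (b ∷ bs) k = ↭-trans (forced-↭ bs _)
    (↭-trans (↭.++⁺ˡ xs (↭.shifts zs ((b , X) ∷ (right b , Z) ∷ [])))
    (↭-trans (↭.shift (b , X) xs _) ↭-refl))
    where
    xs = map (_, X) bs
    zs = map (_, Z) (map right bs)

-- The index sets of the quarter and the odd sum over it.

column : ℕ → ℕ → List Vertex
column zero    d = []
column (suc m) d = (suc m , d) ∷ column m d

-- Built directly in the order of the sweep: larger second index first, and `column` descends in i.
triangle : ℕ → ℕ → List Vertex
triangle zero    d = []
triangle (suc m) d = triangle m (suc d) ++ column (suc m) d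

-- The line just outside `triangle m d`; for d = 0 it consists of the white vertices on the other
-- diagonal.
outer : ℕ → ℕ → List Vertex
outer zero    d = [ (1 , d) ]
outer (suc m) d = (suc (suc m) , d) ∷ outer m (suc d)

∈-column⁻ : ∀ {m d i e} → (i , e) ∈ column m d → e ≡ d × 1 ≤ i × i ≤ m
∈-column⁻ {suc m} (here refl) = refl , s≤s z≤n , ℕ.≤-refl
∈-column⁻ {suc m} (there v∈) with ∈-column⁻ {m} v∈
... | e≡d , 1≤i , i≤m = e≡d , 1≤i , ℕ.m≤n⇒m≤1+n i≤m

∈-column⁺ : ∀ {m d i} → 1 ≤ i → i ≤ m → (i , d) ∈ column m d
∈-column⁺ {zero}  {i = suc i} _ ()
∈-column⁺ {suc m} {i = i} 1≤i i≤1+m with i ℕ.≟ suc m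
... | yes refl = here refl
... | no  i≢   = there (∈-column⁺ 1≤i (ℕ.≤-pred (ℕ.≤∧≢⇒< i≤1+m i≢)))

∈-triangle⁻ : ∀ {m d i e} → (i , e) ∈ triangle m d → 1 ≤ i × d ≤ e × i ℕ.+ e ≤ m ℕ.+ d
∈-triangle⁻ {suc m} {d} v∈ with ∈.∈-++⁻ (triangle m (suc d)) v∈
... | inj₁ v∈t with ∈-triangle⁻ {m} v∈t
...   | 1≤i , d<e , le = 1≤i , ℕ.<⇒≤ d<e , ℕ.≤-trans le (ℕ.≤-reflexive (ℕ.+-suc m d))
∈-triangle⁻ {suc m} {d} v∈ | inj₂ v∈c with ∈-column⁻ {suc m} v∈c
...   | refl , 1≤i , i≤m = 1≤i , ℕ.≤-refl , ℕ.+-monoˡ-≤ d i≤m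

∈-triangle⁺ : ∀ {m d i e} → 1 ≤ i → d ≤ e → i ℕ.+ e ≤ m ℕ.+ d → (i , e) ∈ triangle m d
∈-triangle⁺ {zero}  {d} {suc i} {e} 1≤i d≤e le = ⊥-elim (ℕ.<-irrefl refl
  (ℕ.≤-trans (s≤s (ℕ.≤-trans d≤e (ℕ.m≤n+m e i))) le))
∈-triangle⁺ {suc m} {d} {i} {e} 1≤i d≤e le with d ℕ.≟ e
... | yes refl = ∈.∈-++⁺ʳ (triangle m (suc d)) (∈-column⁺ 1≤i (ℕ.+-cancelʳ-≤ d i (suc m) le))
... | no  d≢e  = ∈.∈-++⁺ˡ (∈-triangle⁺ 1≤i (ℕ.≤∧≢⇒< d≤e d≢e)
                                    (ℕ.≤-trans le (ℕ.≤-reflexive (sym (ℕ.+-suc m d)))))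

∈-outer⁻ : ∀ {m d i e} → (i , e) ∈ outer m d → 1 ≤ i × d ≤ e × i ℕ.+ e ≡ suc (m ℕ.+ d)
∈-outer⁻ {zero}      (here refl) = s≤s z≤n , ℕ.≤-refl , refl
∈-outer⁻ {suc m}     (here refl) = s≤s z≤n , ℕ.≤-refl , refl
∈-outer⁻ {suc m} {d} (there v∈) with ∈-outer⁻ {m} v∈
... | 1≤i , d<e , eq = 1≤i , ℕ.<⇒≤ d<e , trans eq (cong suc (ℕ.+-suc m d))

∈-outer⁺ : ∀ {m d i e} → 1 ≤ i → d ≤ e → i ℕ.+ e ≡ suc (m ℕ.+ d) → (i , e) ∈ outer m d
∈-outer⁺ {m} {d} {i} {e} 1≤i d≤e eq with d ℕ.≟ e
∈-outer⁺ {zero}  {d} {i} 1≤i d≤e eq | yes refl with refl ← ℕ.+-cancelʳ-≡ d i 1 eq = here refl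
∈-outer⁺ {suc m} {d} {i} 1≤i d≤e eq | yes refl with refl ← ℕ.+-cancelʳ-≡ d i (2 ℕ.+ m) eq = here refl
∈-outer⁺ {zero}  {d} {suc i} {e} 1≤i d≤e eq | no d≢e =
  ⊥-elim (d≢e (ℕ.≤-antisym d≤e (ℕ.≤-trans (ℕ.m≤n+m e i) (ℕ.≤-reflexive (ℕ.suc-injective eq)))))
∈-outer⁺ {suc m} {d} 1≤i d≤e eq | no d≢e =
  there (∈-outer⁺ 1≤i (ℕ.≤∧≢⇒< d≤e d≢e) (trans eq (cong suc (sym (ℕ.+-suc m d)))))

column-sorted : ∀ m d → AllPairs _≻_ (column m d)
column-sorted zero    d = []
column-sorted (suc m) d = All.tabulate head ∷ column-sorted m d
  where
  head : ∀ {v} → v ∈ column m d → (suc m , d) ≻ v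
  head {i , e} v∈ with refl , _ , i≤m ← ∈-column⁻ {m} v∈ = inj₂ (refl , s≤s i≤m)

triangle-sorted : ∀ m d → AllPairs _≻_ (triangle m d)
triangle-sorted zero    d = []
triangle-sorted (suc m) d = AllPairs.++⁺ (triangle-sorted m (suc d)) (column-sorted (suc m) d)
  (All.tabulate (λ {u} u∈ → All.tabulate (λ {v} v∈ → cross u v u∈ v∈)))
  where
  cross : ∀ u v → u ∈ triangle m (suc d) → v ∈ column (suc m) d → u ≻ v
  cross (i , e) (j , f) u∈ v∈ with refl , _ ← ∈-column⁻ {suc m} v∈ = inj₁ (proj₁ (proj₂ (∈-triangle⁻ {m} u∈)))

outer-unique : ∀ m d → Unique (outer m d)
outer-unique zero    d = [] ∷ []
outer-unique (suc m) d =
  All.tabulate (λ v∈ → λ { refl → ℕ.<-irrefl refl (proj₁ (proj₂ (∈-outer⁻ {m} v∈))) }) ∷ outer-unique m (suc d)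

module _ (k : ℕ) where
  open Weight onDiagonal

  -- `blacks` has two readings. As black indices it gives the black vertices of the quarter; as
  -- white indices it gives their left neighbours, which are exactly the white vertices of the
  -- quarter off the other diagonal.
  blacks whites : List Vertex
  blacks = triangle k 0
  whites = outer k 0 ++ blacks

  blacks-unique : Unique blacks
  blacks-unique = AllPairs.map ≻⇒≢ (triangle-sorted k 0)

  whites-unique : Unique whites
  whites-unique = Unique.++⁺ (outer-unique k 0) blacks-unique
    (λ (v∈o , v∈b) → ℕ.<-irrefl refl (ℕ.≤-trans (ℕ.≤-reflexive (sym (proj₂ (proj₂ (∈-outer⁻ {k} v∈o)))))
      (proj₂ (proj₂ (∈-triangle⁻ {k} v∈b)))))

  ∈-blacks⁻ : ∀ {i d} → (i , d) ∈ blacks → 1 ≤ i × i ℕ.+ d ≤ k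
  ∈-blacks⁻ v∈ with 1≤i , _ , le ← ∈-triangle⁻ {k} v∈ = 1≤i , ℕ.≤-trans le (ℕ.≤-reflexive (ℕ.+-identityʳ k))

  ∈-blacks⁺ : ∀ {i d} → 1 ≤ i → i ℕ.+ d ≤ k → (i , d) ∈ blacks
  ∈-blacks⁺ 1≤i le = ∈-triangle⁺ 1≤i z≤n (ℕ.≤-trans le (ℕ.≤-reflexive (sym (ℕ.+-identityʳ k))))

  ∈-whites⁻ : ∀ {i d} → (i , d) ∈ whites → 1 ≤ i × i ℕ.+ d ≤ suc k
  ∈-whites⁻ v∈ with ∈.∈-++⁻ (outer k 0) v∈
  ... | inj₁ v∈o with 1≤i , _ , eq ← ∈-outer⁻ {k} v∈o = 1≤i , ℕ.≤-reflexive (trans eq (cong suc (ℕ.+-identityʳ k)))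
  ... | inj₂ v∈b with 1≤i , le ← ∈-blacks⁻ v∈b = 1≤i , ℕ.m≤n⇒m≤1+n le

  ∈-whites⁺ : ∀ {i d} → 1 ≤ i → i ℕ.+ d ≤ suc k → (i , d) ∈ whites
  ∈-whites⁺ {i} {d} 1≤i le with i ℕ.+ d ℕ.≟ suc k
  ... | yes eq = ∈.∈-++⁺ˡ (∈-outer⁺ 1≤i z≤n (trans eq (cong suc (sym (ℕ.+-identityʳ k)))))
  ... | no  ne = ∈.∈-++⁺ʳ (outer k 0) (∈-blacks⁺ 1≤i (ℕ.≤-pred (ℕ.≤∧≢⇒< le ne)))

  neighbours⊆whites : ∀ {b} → b ∈ blacks → All (_∈ whites) (neighbours b)
  neighbours⊆whites {i , d} b∈ with 1≤i , le ← ∈-blacks⁻ b∈ =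
    ∈-whites⁺ 1≤i (ℕ.m≤n⇒m≤1+n le) ∷
    ∈-whites⁺ 1≤i (ℕ.≤-trans (ℕ.≤-reflexive (ℕ.+-suc i d)) (s≤s le)) ∷
    ∈-whites⁺ (s≤s z≤n) (s≤s le) ∷
    above i le
    where
    above : ∀ i → i ℕ.+ d ≤ k → All (_∈ whites) (up (i , d))
    above zero          le = []
    above (suc zero)    le = []
    above (suc (suc i)) le = ∈-whites⁺ (s≤s z≤n) (ℕ.≤-trans (ℕ.≤-reflexive (cong suc (ℕ.+-suc i d))) (ℕ.m≤n⇒m≤1+n le)) ∷ []

  -- In the surviving state every white vertex holds one X. Since `right` is a bijection from
  -- `blacks` onto the white indices with d ≥ 1, each of these also holds one Z. All factors are
  -- then `D₁ X` or `E₂ X Z`, hence 1.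
  S-neighbours-odd : S (map (choices ∘ neighbours) blacks) (λ l → W whites (l ++ map (_, X) (outer k 0))) ≈₂ 1ℤ
  S-neighbours-odd = ≈₂-trans
    (peel {whites} xs (ready (triangle-sorted k 0) (λ b∈ → All.map split (All.tail (neighbours⊆whites b∈))))
      (λ p∈ → ∈.∈-++⁺ˡ p∈ , ∈.∈-map⁺ (_, X) p∈)
      (All.tabulate (λ b∈ → All.map⁺ (All.universal (λ _ ()) (outer k 0)) , ∈.∈-++⁺ʳ (outer k 0) b∈)))
    (≈₂-reflexive (trans (W-symmetric whites rearrange) (∏-one whites factor)))
    where
    xs = map (_, X) (outer k 0)
    zs = map (_, Z) (map right blacks)
    split : ∀ {q} → q ∈ whites → q ∈ outer k 0 ⊎ q ∈ blacks
    split = ∈.∈-++⁻ (outer k 0)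
    rearrange : forced blacks xs ↭ map (_, X) whites ++ zs
    rearrange = ↭-trans (forced-↭ {whites} blacks xs)
      (↭-trans (↭.++⁺ˡ (map (_, X) blacks) (↭.++-comm zs xs)) (↭-trans (↭.shifts (map (_, X) blacks) xs)
      (↭-reflexive (trans (sym (List.++-assoc xs _ zs)) (cong (_++ zs) (sym (List.map-++ (_, X) (outer k 0) blacks)))))))
    ∏-one : (vs : List Vertex) {f : Vertex → ℤ} → (∀ {v} → v ∈ vs → f v ≡ 1ℤ) → ∏ vs f ≡ 1ℤ
    ∏-one []       eq = refl
    ∏-one (v ∷ vs) eq = cong₂ _*_ (eq (here refl)) (∏-one vs (eq ∘ there))
    factor : ∀ {v} → v ∈ whites → E (onDiagonal v) (at v (map (_, X) whites ++ zs)) ≡ 1ℤ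
    factor {v} v∈ rewrite at-++ v (map (_, X) whites) zs | at-∈ {v} {X} whites-unique v∈ = atZ v v∈
      where
      0∉ : ∀ {i} → (i , 0) ∉ map right blacks
      0∉ v∈ with _ , _ , () ← ∈.∈-map⁻ right v∈
      atZ : ∀ v → v ∈ whites → E (onDiagonal v) (X ∷ at v zs) ≡ 1ℤ
      atZ (i , zero) v∈ rewrite at-∉ {i , 0} {Z} {map right blacks} (0∉) = refl
      atZ (i , suc d) v∈ rewrite at-∈ {i , suc d} {Z} {map right blacks}
          (Unique.map⁺ (λ { refl → refl }) blacks-unique)
          (∈.∈-map⁺ right (∈-blacks⁺ (proj₁ (∈-whites⁻ v∈))
            (ℕ.≤-pred (ℕ.≤-trans (ℕ.≤-reflexive (sym (ℕ.+-suc i d))) (proj₂ (∈-whites⁻ v∈)))))) = refl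

-- Reflection in the other diagonal: reduction from the triangle to the quarter.

φ β : Vertex → Vertex
φ (i , d) = i , i ℕ.+ (d ℕ.+ d)
β (i , d) = i , suc (i ℕ.+ (d ℕ.+ d))

onPick : (Vertex → Vertex) → Pick → Pick
onPick g (v , x) = g v , x

≡ᵇ-⇔ : ∀ {m n m′ n′} → (m ≡ n → m′ ≡ n′) → (m′ ≡ n′ → m ≡ n) → (m ≡ᵇ n) ≡ (m′ ≡ᵇ n′)
≡ᵇ-⇔ {m} {n} {m′} {n′} to from with m ≡ᵇ n in eq | m′ ≡ᵇ n′ in eq′
... | true  | true  = refl
... | false | false = refl
... | true  | false = ⊥-elim (subst T eq′ (ℕ.≡⇒≡ᵇ m′ n′ (to (ℕ.≡ᵇ⇒≡ m n (subst T (sym eq) _)))))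
... | false | true  = ⊥-elim (subst T eq (ℕ.≡⇒≡ᵇ m n (from (ℕ.≡ᵇ⇒≡ m′ n′ (subst T (sym eq′) _)))))

==ᵥ-⇔ : ∀ {u v u′ v′} → (u ≡ v → u′ ≡ v′) → (u′ ≡ v′ → u ≡ v) → (u ==ᵥ v) ≡ (u′ ==ᵥ v′)
==ᵥ-⇔ {u} {v} {u′} {v′} to from with u ==ᵥ v in eq | u′ ==ᵥ v′ in eq′
... | true  | true  = refl
... | false | false = refl
... | true  | false with () ← trans (sym eq′) (subst (λ t → (u′ ==ᵥ t) ≡ true) (to (==ᵥ⇒≡ u v eq)) (==ᵥ-refl u′))
... | false | true  with () ← trans (sym eq) (subst (λ t → (u ==ᵥ t) ≡ true) (from (==ᵥ⇒≡ u′ v′ eq′)) (==ᵥ-refl u))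

-- The equivalence is asked only at the vertices occurring in `l`, because `τ` is injective only
-- where its truncated subtraction is exact.
at-map : ∀ g {u w l} → All (λ p → (u ≡ g (proj₁ p) → w ≡ proj₁ p) × (w ≡ proj₁ p → u ≡ g (proj₁ p))) l →
         at u (map (onPick g) l) ≡ at w l
at-map g []                                          = refl
at-map g {u} {w} {(v , x) ∷ l} ((to , from) ∷ h)
  rewrite ==ᵥ-⇔ {u} {g v} {w} {v} to from | at-map g h = refl

at-map-∉ : ∀ g {u} {l : List Pick} → All (λ p → u ≢ g (proj₁ p)) l → at u (map (onPick g) l) ≡ []
at-map-∉ g []                             = refl
at-map-∉ g {l = (v , x) ∷ l} (u≢ ∷ h) = trans (at-other x (map (onPick g) l) u≢) (at-map-∉ g h)

cartesianProduct-map : (g : A → B) (xs ys : List A) →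
  cartesianProduct (map g xs) (map g ys) ≡ map (λ (x , y) → g x , g y) (cartesianProduct xs ys)
cartesianProduct-map g []       ys = refl
cartesianProduct-map g (x ∷ xs) ys = trans
  (cong₂ _++_ (trans (sym (List.map-∘ ys)) (List.map-∘ ys)) (cartesianProduct-map g xs ys))
  (sym (List.map-++ _ (map (x ,_) ys) _))

pairs-map : (g : A → B) (xs : List A) → pairs (map g xs) ≡ map (λ (x , y) → g x , g y) (pairs xs)
pairs-map g []       = refl
pairs-map g (x ∷ xs) = trans
  (cong₂ _++_ (trans (sym (List.map-∘ xs)) (List.map-∘ xs)) (pairs-map g xs))
  (sym (List.map-++ _ (map (x ,_) xs) _))

choices-map : ∀ g N → choices (map g N) ≡ map (map (onPick g)) (choices N)
choices-map g N = trans (cong₂ _++_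
    (trans (cong (map xz) (cartesianProduct-map g N N)) (trans (sym (List.map-∘ (cartesianProduct N N))) (List.map-∘ (cartesianProduct N N))))
    (trans (cong (map xx) (pairs-map g N)) (trans (sym (List.map-∘ (pairs N))) (List.map-∘ (pairs N)))))
  (sym (List.map-++ _ (map xz (cartesianProduct N N)) _))

-- For one label this is the congruence of `E₂ x x` and `E₂ X x` off the diagonal, and 0 = 0 on it;
-- with two or more labels both sides vanish.
E-++-self : ∀ b l → E b (l ++ l) ≈₂ E b (X ∷ l)
E-++-self true  []              = ≈₂-reflexive refl
E-++-self true  (_ ∷ [])        = ≈₂-reflexive refl
E-++-self true  (_ ∷ _ ∷ _)     = ≈₂-reflexive refl
E-++-self false []              = ≈₂-reflexive refl
E-++-self false (X ∷ [])        = ≈₂-reflexive refl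
E-++-self false (Y ∷ [])        = half {h = - 1ℤ} refl
E-++-self false (Z ∷ [])        = half {h = - 1ℤ} refl
E-++-self false (_ ∷ _ ∷ [])    = ≈₂-reflexive refl
E-++-self false (_ ∷ _ ∷ _ ∷ _) = ≈₂-reflexive refl

square-≈₂ : ∀ x → x * x ≈₂ x
square-≈₂ x with parity x
  where
  ℕ-parity : ∀ n → (ℤ.+ n ≈₂ 0ℤ) ⊎ (ℤ.+ n ≈₂ 1ℤ)
  ℕ-parity zero    = inj₁ (≈₂-reflexive refl)
  ℕ-parity (suc n) with ℕ-parity n
  ... | inj₁ even = inj₂ (+-cong-≈₂ (≈₂-reflexive {1ℤ} refl) even)
  ... | inj₂ odd  = inj₁ (≈₂-trans (+-cong-≈₂ (≈₂-reflexive {1ℤ} refl) odd) (half {h = 1ℤ} refl))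
  parity : ∀ x → (x ≈₂ 0ℤ) ⊎ (x ≈₂ 1ℤ)
  parity (ℤ.+ n)    = ℕ-parity n
  parity ℤ.-[1+ n ] with ℕ-parity n
  ... | inj₁ (half {h} eq) = inj₂ (half {h = - 1ℤ - h} (trans (cong (λ t → - (1ℤ + t)) eq) (lemma h)))
    where
    lemma : ∀ h → - (1ℤ + (0ℤ + (h + h))) ≡ 1ℤ + (- 1ℤ - h + (- 1ℤ - h))
    lemma = solve-∀
  ... | inj₂ (half {h} eq) = inj₁ (half {h = - 1ℤ - h} (trans (cong (λ t → - (1ℤ + t)) eq) (lemma h)))
    where
    lemma : ∀ h → - (1ℤ + (1ℤ + (h + h))) ≡ 0ℤ + (- 1ℤ - h + (- 1ℤ - h))
    lemma = solve-∀
... | inj₁ even = ≈₂-trans (*-cong-≈₂ even even) (≈₂-sym even)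
... | inj₂ odd  = ≈₂-trans (*-cong-≈₂ odd odd) (≈₂-sym odd)

diagonal : Vertex → Bool
diagonal (i , j) = i ≡ᵇ j

double-injective : ∀ {m n} → m ℕ.+ m ≡ n ℕ.+ n → m ≡ n
double-injective {m} {n} eq = ℕ.*-cancelˡ-≡ m n 2 (trans (cong (m ℕ.+_) (ℕ.+-identityʳ m))
  (trans eq (sym (cong (n ℕ.+_) (ℕ.+-identityʳ n)))))

φ-injective : ∀ {u v} → φ u ≡ φ v → u ≡ v
φ-injective {i , d} {j , e} eq with refl ← cong proj₁ eq =
  cong (i ,_) (double-injective (ℕ.+-cancelˡ-≡ i _ _ (cong proj₂ eq)))

module Fold (k : ℕ) where

  side : ℕ
  side = suc k ℕ.+ suc k

  τ : Vertex → Vertex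
  τ (i , j) = side ∸ j , side ∸ i

  -- Locates a vertex relative to the other diagonal, where it equals `side`; `τ` reflects it about
  -- this value.
  rank : Vertex → ℕ
  rank (i , j) = i ℕ.+ j

  InBox : Vertex → Set
  InBox (i , j) = i ≤ side × j ≤ side

  τ-involutive : ∀ {v} → InBox v → τ (τ v) ≡ v
  τ-involutive (i≤ , j≤) = cong₂ _,_ (ℕ.m∸[m∸n]≡n i≤) (ℕ.m∸[m∸n]≡n j≤)

  τ-injective : ∀ {u v} → InBox u → InBox v → τ u ≡ τ v → u ≡ v
  τ-injective u∈ v∈ eq = trans (sym (τ-involutive u∈)) (trans (cong τ eq) (τ-involutive v∈))

  τ-rank : ∀ {v} → InBox v → rank (τ v) ℕ.+ rank v ≡ side ℕ.+ side
  τ-rank {i , j} (i≤ , j≤) = begin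
    (side ∸ j ℕ.+ (side ∸ i)) ℕ.+ (i ℕ.+ j)
      ≡⟨ shuffle (side ∸ j) (side ∸ i) i j ⟩
    (side ∸ j ℕ.+ j) ℕ.+ (side ∸ i ℕ.+ i)
      ≡⟨ cong₂ ℕ._+_ (ℕ.m∸n+n≡m j≤) (ℕ.m∸n+n≡m i≤) ⟩
    side ℕ.+ side ∎
    where
    open ≡-Reasoning
    shuffle : ∀ a b c d → (a ℕ.+ b) ℕ.+ (c ℕ.+ d) ≡ (a ℕ.+ d) ℕ.+ (b ℕ.+ c)
    shuffle = ℕS.solve-∀

  rank-φ : ∀ i d → rank (φ (i , d)) ≡ (i ℕ.+ d) ℕ.+ (i ℕ.+ d)
  rank-φ i d = lemma i d
    where
    lemma : ∀ i d → i ℕ.+ (i ℕ.+ (d ℕ.+ d)) ≡ (i ℕ.+ d) ℕ.+ (i ℕ.+ d)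
    lemma = ℕS.solve-∀

  φ-InBox : ∀ {i d} → i ℕ.+ d ≤ suc k → InBox (φ (i , d))
  φ-InBox {i} {d} le = ℕ.≤-trans (ℕ.m≤m+n i _) le′ , ℕ.≤-trans (ℕ.m≤n+m _ i) le′
    where
    le′ : rank (φ (i , d)) ≤ side
    le′ = ℕ.≤-trans (ℕ.≤-reflexive (rank-φ i d)) (ℕ.+-mono-≤ le le)

  whites-InBox : ∀ {v} → v ∈ whites k → InBox (φ v)
  whites-InBox {i , d} v∈ = φ-InBox {i} {d} (proj₂ (∈-whites⁻ k v∈))

  blacks⊆whites : ∀ {v} → v ∈ blacks k → v ∈ whites k
  blacks⊆whites = ∈.∈-++⁺ʳ (outer k 0)

  rank-whites : ∀ {v} → v ∈ whites k → rank (φ v) ≤ side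
  rank-whites {i , d} v∈ = ℕ.≤-trans (ℕ.≤-reflexive (rank-φ i d)) (ℕ.+-mono-≤ le le)
    where le = proj₂ (∈-whites⁻ k v∈)

  rank-blacks : ∀ {v} → v ∈ blacks k → rank (φ v) < side
  rank-blacks {i , d} v∈ = ℕ.≤-trans (s≤s (ℕ.≤-reflexive (rank-φ i d))) (ℕ.+-mono-≤ (s≤s le) (ℕ.m≤n⇒m≤1+n le))
    where le = proj₂ (∈-blacks⁻ k v∈)

  rank-τ-whites : ∀ {v} → v ∈ whites k → side ≤ rank (τ (φ v))
  rank-τ-whites {v} v∈ = ℕ.+-cancelʳ-≤ (rank (φ v)) _ _ (ℕ.≤-trans (ℕ.+-monoʳ-≤ side (rank-whites v∈))
    (ℕ.≤-reflexive (sym (τ-rank (whites-InBox v∈)))))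

  rank-τ-blacks : ∀ {v} → v ∈ blacks k → side < rank (τ (φ v))
  rank-τ-blacks {v} v∈ = ℕ.+-cancelʳ-< (rank (φ v)) _ _ (ℕ.≤-trans (ℕ.+-monoʳ-< side (rank-blacks v∈))
    (ℕ.≤-reflexive (sym (τ-rank (whites-InBox (blacks⊆whites v∈))))))

  τ-outer : ∀ {v} → v ∈ outer k 0 → τ (φ v) ≡ φ v
  τ-outer {i , d} v∈ = cong₂ _,_
    (trans (cong (_∸ (i ℕ.+ (d ℕ.+ d))) side≡) (ℕ.m+n∸n≡m i (i ℕ.+ (d ℕ.+ d))))
    (trans (cong (_∸ i) side≡) (ℕ.m+n∸m≡n i _))
    where
    side≡ : side ≡ i ℕ.+ (i ℕ.+ (d ℕ.+ d))
    side≡ = trans (cong (λ s → s ℕ.+ s) (sym (trans (proj₂ (proj₂ (∈-outer⁻ {k} v∈))) (cong suc (ℕ.+-identityʳ k)))))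
      (sym (rank-φ i d))

  foldedWhites : List Vertex
  foldedWhites = map φ (outer k 0) ++ map φ (blacks k) ++ map (τ ∘ φ) (blacks k)

  quarterLists foldedLists : List (List Vertex)
  quarterLists = map (map φ ∘ neighbours) (blacks k)
  foldedLists  = quarterLists ++ map (map τ) quarterLists

  open Weight using (W)

  onDiagonal-φ : ∀ v → diagonal (φ v) ≡ onDiagonal v
  onDiagonal-φ (i , d) = ≡ᵇ-⇔ {i} {i ℕ.+ (d ℕ.+ d)} {d} {0}
    (λ eq → ℕ.m+n≡0⇒m≡0 d (ℕ.+-cancelˡ-≡ i _ 0 (trans (sym eq) (sym (ℕ.+-identityʳ i)))))
    (λ { refl → sym (ℕ.+-identityʳ i) })

  diagonal-τ : ∀ {v} → InBox v → diagonal (τ v) ≡ diagonal v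
  diagonal-τ {i , j} (i≤ , j≤) = ≡ᵇ-⇔ {side ∸ j} {side ∸ i} {i} {j}
    (λ eq → sym (ℕ.∸-cancelˡ-≡ j≤ i≤ eq)) (λ { refl → refl })

  quarterChoices : List (List (List Pick))
  quarterChoices = map (choices ∘ neighbours) (blacks k)

  InWhites : Pick → Set
  InWhites p = proj₁ p ∈ whites k

  quarterChoices-⊆ : AllChoices InWhites quarterChoices
  quarterChoices-⊆ = All.map⁺ (All.tabulate (λ b∈ → choices-All (neighbours⊆whites k b∈)))

  -- `f` and `g` are states of the quarter and of its mirror image, the latter pulled back by `τ`.
  -- `blacks k` is read here as a set of white indices.
  weight₂ : List Pick → List Pick → ℤ
  weight₂ f g = ∏ (outer k 0) (λ v → E (onDiagonal v) (at v f ++ at v g)) *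
                (W onDiagonal (blacks k) f * W onDiagonal (blacks k) g)

  weight₂-comm : ∀ f g → weight₂ f g ≡ weight₂ g f
  weight₂-comm f g = cong₂ _*_
    (∏-cong (outer k 0) (λ {v} _ → E-symmetric (onDiagonal v) (↭.++-comm (at v f) (at v g))))
    (ℤ.*-comm (W onDiagonal (blacks k) f) _)

  -- The picks of `f` have rank at most `side` and the reflected picks of `g` at least `side`, so
  -- the two states interact only on the other diagonal.
  W-folded : ∀ f g → All InWhites f → All InWhites g →
             W diagonal foldedWhites (map (onPick φ) f ++ map (onPick (τ ∘ φ)) g) ≡ weight₂ f g
  W-folded f g f⊆ g⊆ = trans (∏-++ (map φ (outer k 0)) _) (cong₂ _*_
    (trans (∏-map φ (outer k 0)) (∏-cong (outer k 0) (λ {v} v∈ → cong₂ E (onDiagonal-φ v)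
      (trans (at-++ (φ v) (map (onPick φ) f) _) (cong₂ _++_ at-φ (at-τ′ v∈))))))
    (trans (∏-++ (map φ (blacks k)) _) (cong₂ _*_
      (trans (∏-map φ (blacks k)) (∏-cong (blacks k) (λ {v} v∈ → cong₂ E (onDiagonal-φ v)
        (trans (at-++ (φ v) (map (onPick φ) f) _) (trans (cong₂ _++_ at-φ (low v∈)) (List.++-identityʳ _))))))
      (trans (∏-map (τ ∘ φ) (blacks k)) (∏-cong (blacks k) (λ {v} v∈ → cong₂ E
        (trans (diagonal-τ (whites-InBox (blacks⊆whites v∈))) (onDiagonal-φ v))
        (trans (at-++ (τ (φ v)) (map (onPick φ) f) _) (cong₂ _++_ (high v∈) (at-τ (blacks⊆whites v∈))))))))))
    where
    at-φ : ∀ {v} → at (φ v) (map (onPick φ) f) ≡ at v f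
    at-φ = at-map φ (All.universal (λ _ → φ-injective , cong φ) f)
    at-τ : ∀ {v} → v ∈ whites k → at (τ (φ v)) (map (onPick (τ ∘ φ)) g) ≡ at v g
    at-τ v∈ = at-map (τ ∘ φ) (All.map (λ w∈ →
      (φ-injective ∘ τ-injective (whites-InBox v∈) (whites-InBox w∈)) , cong (τ ∘ φ)) g⊆)
    at-τ′ : ∀ {v} → v ∈ outer k 0 → at (φ v) (map (onPick (τ ∘ φ)) g) ≡ at v g
    at-τ′ v∈ = trans (cong (λ u → at u (map (onPick (τ ∘ φ)) g)) (sym (τ-outer v∈))) (at-τ (∈.∈-++⁺ˡ v∈))
    low : ∀ {v} → v ∈ blacks k → at (φ v) (map (onPick (τ ∘ φ)) g) ≡ []
    low v∈ = at-map-∉ (τ ∘ φ) (All.map (λ w∈ eq → ℕ.<⇒≱ (rank-blacks v∈)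
      (subst (λ u → side ≤ rank u) (sym eq) (rank-τ-whites w∈))) g⊆)
    high : ∀ {v} → v ∈ blacks k → at (τ (φ v)) (map (onPick φ) f) ≡ []
    high v∈ = at-map-∉ φ (All.map (λ w∈ eq → ℕ.<⇒≱ (rank-τ-blacks v∈)
      (subst (λ u → rank u ≤ side) (sym eq) (rank-whites w∈))) f⊆)

  -- On the other diagonal the doubled list is traded for an extra X. Elsewhere the two equal
  -- weights form a square, which is congruent to the weight itself.
  weight₂-self : ∀ f → weight₂ f f ≈₂ W onDiagonal (whites k) (f ++ map (_, X) (outer k 0))
  weight₂-self f = ≈₂-trans
    (*-cong-≈₂ (∏-cong-≈₂ (outer k 0) (λ {v} v∈ → ≈₂-trans (E-++-self (onDiagonal v) (at v f))
        (≈₂-reflexive (trans (E-symmetric (onDiagonal v) (↭.++-comm [ X ] (at v f)))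
          (cong (E (onDiagonal v)) (trans (cong (at v f ++_) (sym (at-∈ (outer-unique k 0) v∈))) (sym (at-++ v f xs))))))))
      (≈₂-trans (square-≈₂ (W onDiagonal (blacks k) f))
        (≈₂-reflexive (∏-cong (blacks k) (λ {v} v∈ → cong (E (onDiagonal v))
          (trans (sym (List.++-identityʳ (at v f))) (trans (cong (at v f ++_) (sym (at-∉ (∉-outer v∈))))
            (sym (at-++ v f xs)))))))))
    (≈₂-reflexive (sym (∏-++ (outer k 0) (blacks k))))
    where
    xs = map (_, X) (outer k 0)
    ∉-outer : ∀ {v} → v ∈ blacks k → v ∉ outer k 0
    ∉-outer v∈b v∈o = ℕ.<-irrefl refl (ℕ.≤-trans (ℕ.≤-reflexive (sym (trans (proj₂ (proj₂ (∈-outer⁻ {k} v∈o)))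
      (cong suc (ℕ.+-identityʳ k))))) (proj₂ (∈-blacks⁻ k v∈b)))

  choices-quarter : ∀ g → map choices (map (map g ∘ neighbours) (blacks k)) ≡ map (map (map (onPick g))) quarterChoices
  choices-quarter g = trans (sym (List.map-∘ (blacks k)))
    (trans (List.map-cong (λ b → choices-map g (neighbours b)) (blacks k)) (List.map-∘ (blacks k)))

  S-folded-odd : S (map choices foldedLists) (W diagonal foldedWhites) ≈₂ 1ℤ
  S-folded-odd = ≈₂-trans (≈₂-reflexive unfold)
    (≈₂-trans (S-diagonal quarterChoices-⊆ (λ f g _ _ → weight₂-comm f g))
    (≈₂-trans (S-cong-≈₂ quarterChoices-⊆ (λ f _ → weight₂-self f)) (S-neighbours-odd k)))
    where
    open ≡-Reasoning
    Cs₁ = map (map (map (onPick φ))) quarterChoices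
    Cs₂ = map (map (map (onPick (τ ∘ φ)))) quarterChoices
    lists≡ : map choices foldedLists ≡ Cs₁ ++ Cs₂
    lists≡ = trans (List.map-++ choices quarterLists _) (cong₂ _++_ (choices-quarter φ)
      (trans (cong (map choices) (trans (sym (List.map-∘ (blacks k))) (List.map-cong (λ b → sym (List.map-∘ (neighbours b))) (blacks k))))
        (choices-quarter (τ ∘ φ))))
    unfold : S (map choices foldedLists) (W diagonal foldedWhites) ≡ S quarterChoices (λ f → S quarterChoices (weight₂ f))
    unfold = begin
      S (map choices foldedLists) w
        ≡⟨ cong (λ Cs → S Cs w) lists≡ ⟩
      S (Cs₁ ++ Cs₂) w
        ≡⟨ S-++ Cs₁ Cs₂ ⟩
      S Cs₁ (λ f → S Cs₂ (λ g → w (f ++ g)))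
        ≡⟨ S-map (onPick φ) quarterChoices ⟩
      S quarterChoices (λ f → S Cs₂ (λ g → w (map (onPick φ) f ++ g)))
        ≡⟨ S-cong quarterChoices (λ f → S-map (onPick (τ ∘ φ)) quarterChoices) ⟩
      S quarterChoices (λ f → S quarterChoices (λ g → w (map (onPick φ) f ++ map (onPick (τ ∘ φ)) g)))
        ≡⟨ S-cong-All quarterChoices-⊆ (λ f f⊆ → S-cong-All quarterChoices-⊆ (λ g g⊆ → W-folded f g f⊆ g⊆)) ⟩
      S quarterChoices (λ f → S quarterChoices (weight₂ f)) ∎
      where w = W diagonal foldedWhites

-- Reflection in the main diagonal: from the whole grid to the triangle.

Unique-map : {f : A → B} {xs : List A} → (∀ {x y} → x ∈ xs → y ∈ xs → f x ≡ f y → x ≡ y) →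
             Unique xs → Unique (map f xs)
Unique-map inj []       = []
Unique-map inj (x∉ ∷ u) =
  All.map⁺ (All.tabulate (λ y∈ eq → All.lookup x∉ y∈ (inj (here refl) (there y∈) eq))) ∷
  Unique-map (λ p q → inj (there p) (there q)) u

∏-filterᵇ : (p : A → Bool) (xs : List A) {f : A → ℤ} → ∏ (filterᵇ p xs) f ≡ ∏ xs (λ x → if p x then f x else 1ℤ)
∏-filterᵇ p []           = refl
∏-filterᵇ p (x ∷ xs) {f} with p x
... | true  = cong (f x *_) (∏-filterᵇ p xs)
... | false = trans (∏-filterᵇ p xs) (sym (ℤ.*-identityˡ _))

∏-const* : ∀ c (xs : List A) {f : A → ℤ} → c ℤ.^ length xs * ∏ xs f ≡ ∏ xs (λ x → c * f x)
∏-const* c []           = refl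
∏-const* c (x ∷ xs) {f} = trans (lemma c (c ℤ.^ length xs) (f x) _) (cong (c * f x *_) (∏-const* c xs))
  where
  lemma : ∀ a b d e → a * b * (d * e) ≡ a * d * (b * e)
  lemma = solve-∀

count : Vertex → List Vertex → ℕ
count v l = length (filterᵇ (v ==ᵥ_) l)

count-++ : ∀ v l l′ → count v (l ++ l′) ≡ count v l ℕ.+ count v l′
count-++ v []      l′ = refl
count-++ v (u ∷ l) l′ with v ==ᵥ u
... | true  = cong suc (count-++ v l l′)
... | false = count-++ v l l′

count-map : ∀ g {u w l} → (∀ {v} → v ∈ l → (u ≡ g v → w ≡ v) × (w ≡ v → u ≡ g v)) → count u (map g l) ≡ count w l
count-map g {l = []}             h = refl
count-map g {u} {w} {l = v ∷ l} h
  rewrite ==ᵥ-⇔ {u} {g v} {w} {v} (proj₁ (h (here refl))) (proj₂ (h (here refl))) with w ==ᵥ v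
... | true  = cong suc (count-map g (h ∘ there))
... | false = count-map g (h ∘ there)

count-∉ : ∀ {v l} → v ∉ l → count v l ≡ 0
count-∉ {v} {[]}    v∉ = refl
count-∉ {v} {u ∷ l} v∉ rewrite ≢⇒==ᵥ {v} {u} (v∉ ∘ here) = count-∉ {v} {l} (v∉ ∘ there)

at-replicate : ∀ v x l → at v (map (_, x) l) ≡ replicate (count v l) x
at-replicate v x []      = refl
at-replicate v x (u ∷ l) with v ==ᵥ u
... | true  = cong (x ∷_) (at-replicate v x l)
... | false = at-replicate v x l

[_≤1] : ℕ → ℤ
[ 0 ≤1]           = 1ℤ
[ 1 ≤1]           = 1ℤ
[ suc (suc _) ≤1] = 0ℤ

E-true-replicate : ∀ m n → E true (replicate m X ++ replicate n Y) ≡ [ m ℕ.+ n ≤1]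
E-true-replicate zero          zero          = refl
E-true-replicate zero          (suc zero)    = refl
E-true-replicate zero          (suc (suc n)) = refl
E-true-replicate (suc zero)    zero          = refl
E-true-replicate (suc zero)    (suc n)       = refl
E-true-replicate (suc (suc m)) n             = refl

E-false-replicate : ∀ m n → E false (replicate m X ++ replicate n Y) ≡ [ m ≤1] * (ℤ.+ 2 * [ n ≤1])
E-false-replicate 0 0                         = refl
E-false-replicate 0 1                         = refl
E-false-replicate 0 2                         = refl
E-false-replicate 0 (suc (suc (suc n)))       = refl
E-false-replicate 1 0                         = refl
E-false-replicate 1 1                         = refl
E-false-replicate 1 (suc (suc n))             = refl
E-false-replicate 2 0                         = refl
E-false-replicate 2 (suc n)                   = refl
E-false-replicate (suc (suc (suc m))) n       = refl

σ : Vertex → Vertex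
σ (i , j) = j , i

σ-injective : ∀ {u v} → σ u ≡ σ v → u ≡ v
σ-injective refl = refl

weight₁ : List Vertex → List Vertex → ℤ
weight₁ vs l = ∏ vs (λ v → [ count v l ≤1])

module Reflect (k : ℕ) where
  open Fold k
  open Weight using (W)

  offDiagonal : List Vertex
  offDiagonal = filterᵇ (not ∘ diagonal) foldedWhites

  ∈-foldedWhites⁻ : ∀ {v} → v ∈ foldedWhites →
                    (∃ λ w → w ∈ whites k × v ≡ φ w) ⊎ (∃ λ w → w ∈ blacks k × v ≡ τ (φ w))
  ∈-foldedWhites⁻ v∈ with ∈.∈-++⁻ (map φ (outer k 0)) v∈
  ... | inj₁ v∈o with w , w∈ , eq ← ∈.∈-map⁻ φ v∈o = inj₁ (w , ∈.∈-++⁺ˡ w∈ , eq)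
  ... | inj₂ v∈b with ∈.∈-++⁻ (map φ (blacks k)) v∈b
  ...   | inj₁ v∈φ with w , w∈ , eq ← ∈.∈-map⁻ φ v∈φ = inj₁ (w , blacks⊆whites w∈ , eq)
  ...   | inj₂ v∈τ = inj₂ (∈.∈-map⁻ (τ ∘ φ) v∈τ)

  φ∈foldedWhites : ∀ {w} → w ∈ whites k → φ w ∈ foldedWhites
  φ∈foldedWhites w∈ with ∈.∈-++⁻ (outer k 0) w∈
  ... | inj₁ w∈o = ∈.∈-++⁺ˡ (∈.∈-map⁺ φ w∈o)
  ... | inj₂ w∈b = ∈.∈-++⁺ʳ (map φ (outer k 0)) (∈.∈-++⁺ˡ (∈.∈-map⁺ φ w∈b))

  τφ∈foldedWhites : ∀ {w} → w ∈ whites k → τ (φ w) ∈ foldedWhites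
  τφ∈foldedWhites w∈ with ∈.∈-++⁻ (outer k 0) w∈
  ... | inj₁ w∈o = subst (_∈ foldedWhites) (sym (τ-outer w∈o)) (φ∈foldedWhites w∈)
  ... | inj₂ w∈b = ∈.∈-++⁺ʳ (map φ (outer k 0)) (∈.∈-++⁺ʳ (map φ (blacks k)) (∈.∈-map⁺ (τ ∘ φ) w∈b))

  foldedWhites-≤ : ∀ {v} → v ∈ foldedWhites → proj₁ v ≤ proj₂ v
  foldedWhites-≤ v∈ with ∈-foldedWhites⁻ v∈
  ... | inj₁ ((i , d) , _ , refl) = ℕ.m≤m+n i _
  ... | inj₂ ((i , d) , _ , refl) = ℕ.∸-monoʳ-≤ side (ℕ.m≤m+n i _)

  foldedWhites-unique : Unique foldedWhites
  foldedWhites-unique = Unique.++⁺ (Unique.map⁺ φ-injective (outer-unique k 0))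
    (Unique.++⁺ (Unique.map⁺ φ-injective (blacks-unique k))
      (Unique-map (λ u∈ v∈ eq → φ-injective (τ-injective (whites-InBox (blacks⊆whites u∈))
        (whites-InBox (blacks⊆whites v∈)) eq)) (blacks-unique k))
      (λ (v∈φ , v∈τ) → φτ-disjoint (∈.∈-map⁻ φ v∈φ) (∈.∈-map⁻ (τ ∘ φ) v∈τ) blacks⊆whites))
    disjoint
    where
    φτ-disjoint : ∀ {vs v} → (∃ λ w → w ∈ vs × v ≡ φ w) → (∃ λ w → w ∈ blacks k × v ≡ τ (φ w)) →
                  (∀ {w} → w ∈ vs → w ∈ whites k) → ⊥
    φτ-disjoint (w , w∈ , refl) (w′ , w′∈ , eq) vs⊆ =
      ℕ.<⇒≱ (rank-τ-blacks w′∈) (subst (λ u → rank u ≤ side) eq (rank-whites (vs⊆ w∈)))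
    disjoint : ∀ {v} → ¬ (v ∈ map φ (outer k 0) × v ∈ map φ (blacks k) ++ map (τ ∘ φ) (blacks k))
    disjoint (v∈o , v∈b) with ∈.∈-++⁻ (map φ (blacks k)) v∈b
    ... | inj₂ v∈τ = φτ-disjoint (∈.∈-map⁻ φ v∈o) (∈.∈-map⁻ (τ ∘ φ) v∈τ) ∈.∈-++⁺ˡ
    ... | inj₁ v∈φ with ∈.∈-map⁻ φ v∈o | ∈.∈-map⁻ φ v∈φ
    ...   | w , w∈ , eq | w′ , w′∈ , eq′ with refl ← φ-injective {w} {w′} (trans (sym eq) eq′) =
      ℕ.<-irrefl (trans (rank-φ (proj₁ w) (proj₂ w)) (cong (λ s → s ℕ.+ s)
        (trans (proj₂ (proj₂ (∈-outer⁻ {k} w∈))) (cong suc (ℕ.+-identityʳ k))))) (rank-blacks w′∈)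

  foldedLists⊆ : All (All (_∈ foldedWhites)) foldedLists
  foldedLists⊆ = All.++⁺
    (All.map⁺ (All.tabulate (λ b∈ → All.map⁺ (All.map φ∈foldedWhites (neighbours⊆whites k b∈)))))
    (All.map⁺ (All.map⁺ (All.tabulate (λ b∈ → All.map⁺ (All.map⁺ (All.map τφ∈foldedWhites (neighbours⊆whites k b∈)))))))

  allWhites : List Vertex
  allWhites = foldedWhites ++ map σ offDiagonal

  allLists : List (List Vertex)
  allLists = foldedLists ++ map (map σ) foldedLists

  -- A vertex v off the diagonal stands for the pair v, `σ v`: only `f` reaches v and only the
  -- reflected `g` reaches `σ v`, so X and Y are bounded separately. A diagonal v is reached by
  -- both, so their total is bounded. The power of 2 spends one factor on each pair.
  weight₁≡W : ∀ f g → All (_∈ foldedWhites) f → All (_∈ foldedWhites) g →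
    (ℤ.+ 2) ℤ.^ length offDiagonal * weight₁ allWhites (f ++ map σ g) ≡
    W diagonal foldedWhites (map (_, X) f ++ map (_, Y) g ++ [])
  weight₁≡W f g f⊆ g⊆ = begin
    c * ∏ (foldedWhites ++ map σ offDiagonal) h
      ≡⟨ cong (c *_) (∏-++ foldedWhites (map σ offDiagonal)) ⟩
    c * (∏ foldedWhites h * ∏ (map σ offDiagonal) h)
      ≡⟨ lemma c (∏ foldedWhites h) _ ⟩
    ∏ foldedWhites h * (c * ∏ (map σ offDiagonal) h)
      ≡⟨ cong (∏ foldedWhites h *_) (trans (cong (c *_) (∏-map σ offDiagonal))
           (trans (∏-const* (ℤ.+ 2) offDiagonal) (∏-filterᵇ (not ∘ diagonal) foldedWhites))) ⟩
    ∏ foldedWhites h * ∏ foldedWhites h′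
      ≡⟨ ∏-* foldedWhites ⟨
    ∏ foldedWhites (λ v → h v * h′ v)
      ≡⟨ ∏-cong foldedWhites (λ {v} v∈ → factor v v∈) ⟩
    W diagonal foldedWhites (map (_, X) f ++ map (_, Y) g ++ []) ∎
    where
    open ≡-Reasoning
    c = (ℤ.+ 2) ℤ.^ length offDiagonal
    h h′ : Vertex → ℤ
    h v  = [ count v (f ++ map σ g) ≤1]
    h′ v = if not (diagonal v) then ℤ.+ 2 * h (σ v) else 1ℤ
    lemma : ∀ a b d → a * (b * d) ≡ b * (a * d)
    lemma = solve-∀
    atXY : ∀ v → at v (map (_, X) f ++ map (_, Y) g ++ []) ≡ replicate (count v f) X ++ replicate (count v g) Y
    atXY v = trans (cong (λ l → at v (map (_, X) f ++ l)) (List.++-identityʳ _))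
      (trans (at-++ v (map (_, X) f) _) (cong₂ _++_ (at-replicate v X f) (at-replicate v Y g)))
    count-σ : ∀ v → count (σ v) (map σ g) ≡ count v g
    count-σ v = count-map σ {σ v} {v} {g} (λ _ → σ-injective , cong σ)
    factor : ∀ v → v ∈ foldedWhites → h v * h′ v ≡ E (diagonal v) (at v (map (_, X) f ++ map (_, Y) g ++ []))
    factor v@(i , j) v∈ rewrite atXY v with i ≡ᵇ j in eq
    ... | true with refl ← ℕ.≡ᵇ⇒≡ i j (subst T (sym eq) _) = trans (ℤ.*-identityʳ _)
      (trans (cong [_≤1] (trans (count-++ v f (map σ g)) (cong (count v f ℕ.+_) (count-σ v))))
        (sym (E-true-replicate (count v f) (count v g))))
    ... | false = trans (cong₂ (λ m n → [ m ≤1] * (ℤ.+ 2 * [ n ≤1]))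
        (trans (count-++ v f (map σ g)) (trans (cong (count v f ℕ.+_) (count-∉ {v} {map σ g} v∉σg)) (ℕ.+-identityʳ _)))
        (trans (count-++ (σ v) f (map σ g)) (cong₂ ℕ._+_ (count-∉ {σ v} {f} σv∉f) (count-σ v))))
      (sym (E-false-replicate (count v f) (count v g)))
      where
      i<j : i < j
      i<j = ℕ.≤∧≢⇒< (foldedWhites-≤ v∈) (λ { refl → subst T eq (ℕ.≡⇒≡ᵇ i i refl) })
      v∉σg : v ∉ map σ g
      v∉σg v∈σg with u , u∈ , refl ← ∈.∈-map⁻ σ v∈σg = ℕ.<⇒≱ i<j (foldedWhites-≤ (All.lookup g⊆ u∈))
      σv∉f : σ v ∉ f
      σv∉f σv∈ = ℕ.<⇒≱ i<j (foldedWhites-≤ (All.lookup f⊆ σv∈))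

  S-fold : (ℤ.+ 2) ℤ.^ length offDiagonal * S (map (map [_]) allLists) (weight₁ allWhites) ≡
           (ℤ.+ 2) ℤ.^ length foldedLists * S (map choices foldedLists) (W diagonal foldedWhites)
  S-fold = begin
    c * S (map (map [_]) allLists) w
      ≡⟨ cong (λ Ds → c * S Ds w) lists≡ ⟩
    c * S (Cs ++ map (map (map σ)) Cs) w
      ≡⟨ cong (c *_) (trans (S-++ Cs _) (S-cong Cs (λ f → S-map σ Cs))) ⟩
    c * S Cs (λ f → S Cs (λ g → w (f ++ map σ g)))
      ≡⟨ trans (*-S c Cs) (S-cong Cs (λ f → *-S c Cs)) ⟩
    S Cs (λ f → S Cs (λ g → c * w (f ++ map σ g)))
      ≡⟨ S-cong-All Cs⊆ (λ f f⊆ → S-cong-All Cs⊆ (λ g g⊆ → weight₁≡W f g f⊆ g⊆)) ⟩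
    S Cs (λ f → S Cs (λ g → W diagonal foldedWhites (map (_, X) f ++ map (_, Y) g ++ [])))
      ≡⟨ S-S≡double foldedLists ⟩
    double foldedLists (λ f g → W diagonal foldedWhites (map (_, X) f ++ map (_, Y) g ++ []))
      ≡⟨ BaseChange.double≡S-choices diagonal foldedWhites-unique [] foldedLists⊆ ⟩
    (ℤ.+ 2) ℤ.^ length foldedLists * S (map choices foldedLists) (λ l → W diagonal foldedWhites (l ++ []))
      ≡⟨ cong ((ℤ.+ 2) ℤ.^ length foldedLists *_) (S-cong (map choices foldedLists)
           (λ l → cong (W diagonal foldedWhites) (List.++-identityʳ l))) ⟩
    (ℤ.+ 2) ℤ.^ length foldedLists * S (map choices foldedLists) (W diagonal foldedWhites) ∎
    where
    open ≡-Reasoning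
    c  = (ℤ.+ 2) ℤ.^ length offDiagonal
    w  = weight₁ allWhites
    Cs = map (map [_]) foldedLists
    Cs⊆ : AllChoices (_∈ foldedWhites) Cs
    Cs⊆ = All.map⁺ (All.map (λ N⊆ → All.map⁺ (All.map (_∷ []) N⊆)) foldedLists⊆)
    lists≡ : map (map [_]) allLists ≡ Cs ++ map (map (map σ)) Cs
    lists≡ = trans (List.map-++ (map [_]) foldedLists _) (cong (Cs ++_)
      (trans (sym (List.map-∘ foldedLists)) (trans (List.map-cong (λ N → trans (sym (List.map-∘ N)) (List.map-∘ N)) foldedLists)
        (List.map-∘ foldedLists))))

-- From subsets of edges to one choice per black vertex.

⟦_⟧ : Bool → ℤ
⟦ true ⟧  = 1ℤ
⟦ false ⟧ = 0ℤ

-- Turns a subset into an independent choice for every edge, so that `subsets` becomes an instance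
-- of `S`.
include : A → List (List A)
include x = [] ∷ [ x ] ∷ []

∑-subsets : (xs : List A) {w : List A → ℤ} → ∑ (subsets xs) w ≡ S (map include xs) w
∑-subsets []           = ℤ.+-identityʳ _
∑-subsets (x ∷ xs) {w} = trans (∑-++ (subsets xs) _) (cong₂ _+_ (∑-subsets xs)
  (trans (∑-map (x ∷_) (subsets xs)) (trans (∑-subsets xs) (sym (ℤ.+-identityʳ _)))))

length-filterᵇ : (p : A → Bool) (xs : List A) → ℤ.+ length (filterᵇ p xs) ≡ ∑ xs (⟦_⟧ ∘ p)
length-filterᵇ p []       = refl
length-filterᵇ p (x ∷ xs) with p x
... | true  = cong (1ℤ +_) (length-filterᵇ p xs)
... | false = trans (length-filterᵇ p xs) (sym (ℤ.+-identityˡ _))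

[_≡1] : ℕ → ℤ
[ n ≡1] = ⟦ n ≡ᵇ 1 ⟧

S-include-empty : (xs : List A) {g : List A → ℤ} → S (map include xs) (λ l → [ suc (length l) ≡1] * g l) ≡ g []
S-include-empty [] {g}       = ℤ.*-identityˡ (g [])
S-include-empty (x ∷ xs) {g} = trans (cong₂ _+_ (S-include-empty xs)
  (trans (ℤ.+-identityʳ _) (trans (S-cong (map include xs) (λ l → ℤ.*-zeroˡ (g (x ∷ l)))) (S-zero (map include xs)))))
  (ℤ.+-identityʳ _)

S-include-singleton : (xs : List A) {g : List A → ℤ} →
                      S (map include xs) (λ l → [ length l ≡1] * g l) ≡ ∑ xs (λ x → g [ x ])
S-include-singleton [] {g}       = ℤ.*-zeroˡ (g [])
S-include-singleton (x ∷ xs) {g} = trans (cong₂ _+_ (S-include-singleton xs)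
  (trans (ℤ.+-identityʳ _) (S-include-empty xs))) (ℤ.+-comm _ (g [ x ]))

Star : Set
Star = Vertex × List Vertex

edgesOf : Star → List Edge
edgesOf (b , N) = map (b ,_) N

count-≡-length : ∀ b (es : List Edge) → All (λ e → proj₁ e ≡ b) es → count b (map proj₁ es) ≡ length es
count-≡-length b []       []         = refl
count-≡-length b (e ∷ es) (refl ∷ h) rewrite ==ᵥ-refl b = cong suc (count-≡-length b es h)

∉-map : {f : A → B} {b : B} {xs : List A} → All (λ x → f x ≢ b) xs → b ∉ map f xs
∉-map h b∈ with x , x∈ , eq ← ∈.∈-map⁻ _ b∈ = All.lookup h x∈ (sym eq)

include-All : {P : A → Set} {xs : List A} → All P xs → AllChoices P (map include xs)
include-All ps = All.map⁺ (All.map (λ p → [] ∷ (p ∷ []) ∷ []) ps)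

edgesOf-All : ∀ {P : Edge → Set} {stars} → (∀ {b N w} → (b , N) ∈ stars → w ∈ N → P (b , w)) →
              All P (concatMap edgesOf stars)
edgesOf-All {stars = []}            h = []
edgesOf-All {stars = (b , N) ∷ stars} h =
  All.++⁺ (All.map⁺ (All.tabulate (h (here refl)))) (edgesOf-All (h ∘ there))

-- The centres are distinct and each edge starts at its centre, so the degree condition at `b`
-- concerns only the star of `b`; among the subsets of that star it selects the single edges.
S-stars : ∀ {stars} → Unique (map proj₁ stars) → (w : List Vertex → ℤ) →
  S (map include (concatMap edgesOf stars))
    (λ P → ∏ (map proj₁ stars) (λ b → [ count b (map proj₁ P) ≡1]) * w (map proj₂ P)) ≡
  S (map (map [_] ∘ proj₂) stars) w
S-stars {[]}              _        w = ℤ.*-identityˡ _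
S-stars {(b , N) ∷ stars} (b∉ ∷ u) w = begin
  S (map include (map (b ,_) N ++ rest)) F
    ≡⟨ trans (cong (λ Cs → S Cs F) (List.map-++ include (map (b ,_) N) rest)) (S-++ (map include (map (b ,_) N)) Cs) ⟩
  S (map include (map (b ,_) N)) (λ c → S Cs (λ P → F (c ++ P)))
    ≡⟨ S-cong-All (include-All {P = λ e → proj₁ e ≡ b} (All.map⁺ (All.universal (λ _ → refl) N))) inner ⟩
  S (map include (map (b ,_) N)) (λ c → [ length c ≡1] * G (map proj₂ c))
    ≡⟨ S-include-singleton (map (b ,_) N) ⟩
  ∑ (map (b ,_) N) (λ e → G [ proj₂ e ])
    ≡⟨ trans (∑-map (b ,_) N) (sym (∑-map [_] N)) ⟩
  ∑ (map [_] N) G ∎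
  where
  open ≡-Reasoning
  rest = concatMap edgesOf stars
  Cs   = map include rest
  F : List Edge → ℤ
  F P = ∏ (b ∷ map proj₁ stars) (λ b → [ count b (map proj₁ P) ≡1]) * w (map proj₂ P)
  G : List Vertex → ℤ
  G c = S (map (map [_] ∘ proj₂) stars) (λ l → w (c ++ l))
  later : AllChoices (λ e → proj₁ e ≢ b) Cs
  later = include-All (edgesOf-All (λ s∈ _ → All.lookup b∉ (∈.∈-map⁺ proj₁ s∈) ∘ sym))
  inner : ∀ c → All (λ e → proj₁ e ≡ b) c → S Cs (λ P → F (c ++ P)) ≡ [ length c ≡1] * G (map proj₂ c)
  inner c c≡b = begin
    S Cs (λ P → F (c ++ P))
      ≡⟨ S-cong-All later split ⟩
    S Cs (λ P → [ length c ≡1] * F′ P)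
      ≡⟨ *-S [ length c ≡1] Cs ⟨
    [ length c ≡1] * S Cs F′
      ≡⟨ cong ([ length c ≡1] *_) (S-stars u (λ l → w (map proj₂ c ++ l))) ⟩
    [ length c ≡1] * G (map proj₂ c) ∎
    where
    F′ : List Edge → ℤ
    F′ P = ∏ (map proj₁ stars) (λ b → [ count b (map proj₁ P) ≡1]) * w (map proj₂ c ++ map proj₂ P)
    split : ∀ P → All (λ e → proj₁ e ≢ b) P → F (c ++ P) ≡ [ length c ≡1] * F′ P
    split P P≢b rewrite List.map-++ proj₁ c P | List.map-++ proj₂ c P = trans
      (cong (_* w (map proj₂ c ++ map proj₂ P)) (cong₂ _*_
        (cong [_≡1] (trans (count-++ b (map proj₁ c) (map proj₁ P))
          (trans (cong₂ ℕ._+_ (count-≡-length b c c≡b) (count-∉ {b} (∉-map P≢b))) (ℕ.+-identityʳ _))))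
        (∏-cong (map proj₁ stars) (λ {b′} b′∈ → cong [_≡1] (trans (count-++ b′ (map proj₁ c) (map proj₁ P))
          (cong (ℕ._+ count b′ (map proj₁ P)) (count-∉ {b′} (∉-map
            (All.map (λ e≡b e≡b′ → All.lookup b∉ b′∈ (trans (sym e≡b) e≡b′)) c≡b)))))))))
      (ℤ.*-assoc [ length c ≡1] _ _)

-- Near-perfect matchings of a bipartite graph.

nearPerfect : List Vertex → (Vertex → ℕ) → Bool
nearPerfect V c = allᵇ (λ v → c v ≤ᵇ 1) V ∧ (length (filterᵇ (λ v → c v ≡ᵇ 0) V) ≡ᵇ 1)

zeros : (Vertex → ℕ) → List Vertex → ℕ
zeros c V = length (filterᵇ (λ v → c v ≡ᵇ 0) V)

nearPerfect-∏ : ∀ V c → ⟦ nearPerfect V c ⟧ ≡ ∏ V (λ v → [ c v ≤1]) * [ zeros c V ≡1]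
nearPerfect-∏ V c = go V (zeros c V ≡ᵇ 1)
  where
  [≤1]≡ : ∀ n → ⟦ n ≤ᵇ 1 ⟧ ≡ [ n ≤1]
  [≤1]≡ zero          = refl
  [≤1]≡ (suc zero)    = refl
  [≤1]≡ (suc (suc _)) = refl
  ⟦∧⟧ : ∀ a b → ⟦ a ∧ b ⟧ ≡ ⟦ a ⟧ * ⟦ b ⟧
  ⟦∧⟧ true  b = sym (ℤ.*-identityˡ _)
  ⟦∧⟧ false b = sym (ℤ.*-zeroˡ ⟦ b ⟧)
  go : ∀ V b → ⟦ allᵇ (λ v → c v ≤ᵇ 1) V ∧ b ⟧ ≡ ∏ V (λ v → [ c v ≤1]) * ⟦ b ⟧
  go V b = trans (⟦∧⟧ (allᵇ (λ v → c v ≤ᵇ 1) V) b) (cong (_* ⟦ b ⟧) (all V))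
    where
    all : ∀ V → ⟦ allᵇ (λ v → c v ≤ᵇ 1) V ⟧ ≡ ∏ V (λ v → [ c v ≤1])
    all []      = refl
    all (v ∷ V) = trans (⟦∧⟧ (c v ≤ᵇ 1) _) (cong₂ _*_ ([≤1]≡ (c v)) (all V))

zeros-cong : ∀ {c c′} V → (∀ {v} → v ∈ V → c v ≡ c′ v) → zeros c V ≡ zeros c′ V
zeros-cong          []      eq = refl
zeros-cong {c} {c′} (v ∷ V) eq rewrite eq {v} (here refl) with c′ v ≡ᵇ 0
... | true  = cong suc (zeros-cong V (eq ∘ there))
... | false = zeros-cong V (eq ∘ there)

zeros-++ : ∀ c U V → zeros c (U ++ V) ≡ zeros c U ℕ.+ zeros c V
zeros-++ c []      V = refl
zeros-++ c (v ∷ U) V with c v ≡ᵇ 0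
... | true  = cong suc (zeros-++ c U V)
... | false = zeros-++ c U V

-- Some degree is at least 2, or all degrees are 1, or all are at most 1 with `suc z` of them zero.
-- The last two cases record the degree sum, through which the two colour classes are compared.
data Profile (c : Vertex → ℕ) (V : List Vertex) : Set where
  crowded : ∏ V (λ v → [ c v ≤1]) ≡ 0ℤ → ∏ V (λ v → [ c v ≡1]) ≡ 0ℤ → Profile c V
  perfect : ∏ V (λ v → [ c v ≤1]) ≡ 1ℤ → ∏ V (λ v → [ c v ≡1]) ≡ 1ℤ → zeros c V ≡ 0 →
            sum (map c V) ≡ length V → Profile c V
  holes   : ∀ z → ∏ V (λ v → [ c v ≤1]) ≡ 1ℤ → ∏ V (λ v → [ c v ≡1]) ≡ 0ℤ → zeros c V ≡ suc z →
            sum (map c V) ℕ.+ suc z ≡ length V → Profile c V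

zeros-∷-zero : ∀ {c v} V → c v ≡ 0 → zeros c (v ∷ V) ≡ suc (zeros c V)
zeros-∷-zero V eq rewrite eq = refl

zeros-∷-suc : ∀ {c v n} V → c v ≡ suc n → zeros c (v ∷ V) ≡ zeros c V
zeros-∷-suc V eq rewrite eq = refl

profile : ∀ c V → Profile c V
profile c []      = perfect refl refl refl refl
profile c (v ∷ V) = extend (c v) refl (profile c V)
  where
  cons : ∀ (f : ℕ → ℤ) {n x y} → c v ≡ n → x ≡ y → f (c v) * x ≡ f n * y
  cons f eq eq′ = cong₂ _*_ (cong f eq) eq′
  extend : ∀ n → c v ≡ n → Profile c V → Profile c (v ∷ V)
  extend (suc (suc n)) eq _ = crowded
    (trans (cons [_≤1] eq refl) (ℤ.*-zeroˡ (∏ V (λ v → [ c v ≤1]))))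
    (trans (cons [_≡1] eq refl) (ℤ.*-zeroˡ (∏ V (λ v → [ c v ≡1]))))
  extend n eq (crowded p q) = crowded (trans (cons [_≤1] eq p) (ℤ.*-zeroʳ [ n ≤1])) (trans (cons [_≡1] eq q) (ℤ.*-zeroʳ [ n ≡1]))
  extend 0 eq (perfect p q z s) = holes 0 (cons [_≤1] eq p) (cons [_≡1] eq q)
    (trans (zeros-∷-zero {c} V eq) (cong suc z)) (trans (ℕ.+-comm (sum (map c (v ∷ V))) 1) (cong suc (cong₂ ℕ._+_ eq s)))
  extend 1 eq (perfect p q z s) = perfect (cons [_≤1] eq p) (cons [_≡1] eq q)
    (trans (zeros-∷-suc {c} V eq) z) (cong₂ ℕ._+_ eq s)
  extend 0 eq (holes z p q ze s) = holes (suc z) (cons [_≤1] eq p) (cons [_≡1] eq q)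
    (trans (zeros-∷-zero {c} V eq) (cong suc ze))
    (trans (cong (λ m → m ℕ.+ sum (map c V) ℕ.+ suc (suc z)) eq) (trans (ℕ.+-suc (sum (map c V)) (suc z)) (cong suc s)))
  extend 1 eq (holes z p q ze s) = holes z (cons [_≤1] eq p) (cons [_≡1] eq q)
    (trans (zeros-∷-suc {c} V eq) ze) (trans (cong (λ m → m ℕ.+ sum (map c V) ℕ.+ suc z) eq) (cong suc s))

-- Equal degree sums force one more unmatched vertex in W than in B.
nearPerfect-bipartite : ∀ c B W → length W ≡ suc (length B) → sum (map c B) ≡ sum (map c W) →
  ⟦ nearPerfect (B ++ W) c ⟧ ≡ ∏ B (λ v → [ c v ≡1]) * ∏ W (λ v → [ c v ≤1])
nearPerfect-bipartite c B W |W| degrees = trans (nearPerfect-∏ (B ++ W) c)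
  (trans (cong₂ (λ x n → x * [ n ≡1]) (∏-++ B W) (zeros-++ c B W)) (cases (profile c B) (profile c W)))
  where
  b≤ = ∏ B (λ v → [ c v ≤1])
  b₁ = ∏ B (λ v → [ c v ≡1])
  w≤ = ∏ W (λ v → [ c v ≤1])
  cases : Profile c B → Profile c W → b≤ * w≤ * [ zeros c B ℕ.+ zeros c W ≡1] ≡ b₁ * w≤
  cases (crowded p q) _ = trans (cong (λ x → x * w≤ * [ zeros c B ℕ.+ zeros c W ≡1]) p) (cong (_* w≤) (sym q))
  cases _ (crowded p _) = trans (cong (λ x → b≤ * x * [ zeros c B ℕ.+ zeros c W ≡1]) p)
    (trans (cong (_* [ zeros c B ℕ.+ zeros c W ≡1]) (ℤ.*-zeroʳ b≤)) (sym (trans (cong (b₁ *_) p) (ℤ.*-zeroʳ b₁))))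
  cases (perfect _ _ _ s) (perfect _ _ _ s′) =
    ⊥-elim (ℕ.m≢1+m+n _ {0} (trans (trans (sym s) (trans degrees s′)) (trans |W| (cong suc (sym (ℕ.+-identityʳ _))))))
  cases (perfect p q z s) (holes z′ p′ _ ze s′)
    with refl ← ℕ.+-cancelˡ-≡ (length B) (suc z′) 1
                  (trans (cong (ℕ._+ suc z′) (trans (sym s) degrees)) (trans s′ (trans |W| (ℕ.+-comm 1 (length B)))))
    rewrite p | q | p′ | z | ze = refl
  cases (holes z _ _ _ s) (perfect _ _ _ s′) =
    ⊥-elim (ℕ.m≢1+m+n (length B) {suc z} (trans (sym s)
      (cong (ℕ._+ suc z) (trans degrees (trans s′ |W|)))))
  cases (holes z p q ze s) (holes z′ p′ _ ze′ s′) rewrite p | q | p′ | ze | ze′ | ℕ.+-suc z z′ = refl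

-- Parity, symmetries of the grid, and the neighbourhoods of black vertices.

par : ℕ → Bool
par zero    = false
par (suc n) = not (par n)

par-+ : ∀ m n → par (m ℕ.+ n) ≡ par m xor par n
par-+ zero    n = refl
par-+ (suc m) n = trans (cong not (par-+ m n)) (not-xor (par m) (par n))
  where
  not-xor : ∀ a b → not (a xor b) ≡ not a xor b
  not-xor true  true  = refl
  not-xor true  false = refl
  not-xor false b     = refl

par-double : ∀ n → par (n ℕ.+ n) ≡ false
par-double n = trans (par-+ n n) (self (par n))
  where
  self : ∀ a → a xor a ≡ false
  self true  = refl
  self false = refl

halve : ∀ n → ∃ λ d → n ≡ d ℕ.+ d ⊎ n ≡ suc (d ℕ.+ d)
halve zero = 0 , inj₁ refl
halve (suc n) with halve n
... | d , inj₁ refl = d , inj₂ refl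
... | d , inj₂ refl = suc d , inj₁ (cong suc (sym (ℕ.+-suc d d)))

halve-≤ : ∀ m n → m ℕ.+ m ≤ n ℕ.+ n → m ≤ n
halve-≤ m n le with m ℕ.≤? n
... | yes m≤n = m≤n
... | no  m≰n = ⊥-elim (ℕ.<⇒≱ (ℕ.+-mono-< (ℕ.≰⇒> m≰n) (ℕ.≰⇒> m≰n)) le)

Step : Vertex → Vertex → Set
Step (i , j) v = v ≡ (i , suc j) ⊎ v ≡ (suc i , j)

Adjacent : Vertex → Vertex → Set
Adjacent u v = Step u v ⊎ Step v u

step-σ : ∀ {u v} → Step u v → Step (σ u) (σ v)
step-σ (inj₁ refl) = inj₂ refl
step-σ (inj₂ refl) = inj₁ refl

adjacent-σ : ∀ {u v} → Adjacent u v → Adjacent (σ u) (σ v)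
adjacent-σ (inj₁ s) = inj₁ (step-σ s)
adjacent-σ (inj₂ s) = inj₂ (step-σ s)

Unique⇒↭ : {xs ys : List A} → Unique xs → Unique ys → (∀ {x} → x ∈ xs → x ∈ ys) → (∀ {x} → x ∈ ys → x ∈ xs) → xs ↭ ys
Unique⇒↭ u u′ to from = ∼bag⇒↭ (unique∧set⇒bag u u′ (mk⇔ to from))

∈-range⁺ : ∀ {n i} → 1 ≤ i → i ≤ n → i ∈ range n
∈-range⁺ {i = suc i} _ i≤n = ∈.∈-map⁺ suc (∈.∈-upTo⁺ i≤n)

∈-range⁻ : ∀ {n i} → i ∈ range n → 1 ≤ i × i ≤ n
∈-range⁻ i∈ with j , j∈ , refl ← ∈.∈-map⁻ suc i∈ = s≤s z≤n , ∈.∈-upTo⁻ j∈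

range-unique : ∀ n → Unique (range n)
range-unique n = Unique.map⁺ ℕ.suc-injective (Unique.upTo⁺ n)

concatMap-map : (f : A → B → C) (xs : List A) (ys : List B) →
                concatMap (λ x → map (f x) ys) xs ≡ cartesianProductWith f xs ys
concatMap-map f []       ys = refl
concatMap-map f (x ∷ xs) ys = cong (map (f x) ys ++_) (concatMap-map f xs ys)

onStar : (Vertex → Vertex) → Star → Star
onStar g (b , N) = g b , map g N

map-proj₁-onStar : ∀ g stars → map proj₁ (map (onStar g) stars) ≡ map g (map proj₁ stars)
map-proj₁-onStar g stars = trans (sym (List.map-∘ stars)) (List.map-∘ stars)

map-proj₂-onStar : ∀ g stars → map proj₂ (map (onStar g) stars) ≡ map (map g) (map proj₂ stars)
map-proj₂-onStar g stars = trans (sym (List.map-∘ stars)) (List.map-∘ stars)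

edgesOf-unique : ∀ {stars} → Unique (map proj₁ stars) → All (Unique ∘ proj₂) stars → Unique (concatMap edgesOf stars)
edgesOf-unique {[]}              _        _         = []
edgesOf-unique {(b , N) ∷ stars} (b∉ ∷ u) (uN ∷ us) = Unique.++⁺
  (Unique.map⁺ (λ { refl → refl }) uN) (edgesOf-unique u us) disjoint
  where
  later : All (λ e → proj₁ e ≢ b) (concatMap edgesOf stars)
  later = edgesOf-All (λ s∈ _ → All.lookup b∉ (∈.∈-map⁺ proj₁ s∈) ∘ sym)
  disjoint : ∀ {e} → ¬ (e ∈ map (b ,_) N × e ∈ concatMap edgesOf stars)
  disjoint (e∈ , e∈′) with w , w∈ , refl ← ∈.∈-map⁻ (b ,_) e∈ = All.lookup later e∈′ refl

∈-edgesOf⁺ : ∀ {stars b N w} → (b , N) ∈ stars → w ∈ N → (b , w) ∈ concatMap edgesOf stars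
∈-edgesOf⁺ {s ∷ stars} (here refl) w∈ = ∈.∈-++⁺ˡ (∈.∈-map⁺ _ w∈)
∈-edgesOf⁺ {s ∷ stars} (there s∈)  w∈ = ∈.∈-++⁺ʳ (edgesOf s) (∈-edgesOf⁺ s∈ w∈)

module Grid (k : ℕ) where
  open Fold k
  open Reflect k

  n : ℕ
  n = suc (2 ℕ.* k)

  side≡ : side ≡ suc n
  side≡ = lemma k
    where
    lemma : ∀ k → suc k ℕ.+ suc k ≡ suc (suc (k ℕ.+ (k ℕ.+ 0)))
    lemma = ℕS.solve-∀

  InSide : ℕ → Set
  InSide i = 1 ≤ i × i ≤ n

  InGrid : Vertex → Set
  InGrid (i , j) = InSide i × InSide j

  inSide-∸ : ∀ {i} → InSide i → InSide (side ∸ i)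
  inSide-∸ {i} (1≤i , i≤n) rewrite side≡ =
    ℕ.≤-trans (ℕ.≤-reflexive (sym (ℕ.m+n∸n≡m 1 i))) (ℕ.∸-monoˡ-≤ i (s≤s i≤n)) , ℕ.∸-monoʳ-≤ (suc n) 1≤i

  τ-InGrid : ∀ {v} → InGrid v → InGrid (τ v)
  τ-InGrid (i∈ , j∈) = inSide-∸ j∈ , inSide-∸ i∈

  InGrid⇒InBox : ∀ {v} → InGrid v → InBox v
  InGrid⇒InBox ((_ , i≤n) , (_ , j≤n)) rewrite side≡ = ℕ.m≤n⇒m≤1+n i≤n , ℕ.m≤n⇒m≤1+n j≤n

  suc-∸ : ∀ {j} → suc j ≤ side → side ∸ j ≡ suc (side ∸ suc j)
  suc-∸ {j} le = ℕ.+-∸-assoc 1 le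

  step-τ : ∀ {u v} → InBox v → Step u v → Step (τ v) (τ u)
  step-τ {i , j} (_ , le) (inj₁ refl) = inj₂ (cong (_, side ∸ i) (suc-∸ le))
  step-τ {i , j} (le , _) (inj₂ refl) = inj₁ (cong (side ∸ j ,_) (suc-∸ le))

  adjacent-τ : ∀ {u v} → InBox u → InBox v → Adjacent u v → Adjacent (τ u) (τ v)
  adjacent-τ u∈ v∈ (inj₁ s) = inj₂ (step-τ v∈ s)
  adjacent-τ u∈ v∈ (inj₂ s) = inj₁ (step-τ u∈ s)

  quarterStars foldedStars allStars : List Star
  quarterStars = map (λ b → β b , map φ (neighbours b)) (blacks k)
  foldedStars  = quarterStars ++ map (onStar τ) quarterStars
  allStars     = foldedStars ++ map (onStar σ) foldedStars

  allBlacks : List Vertex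
  allBlacks = map proj₁ allStars

  lists≡ : map proj₂ allStars ≡ allLists
  lists≡ = trans (List.map-++ proj₂ foldedStars _) (cong₂ _++_ folded≡
      (trans (map-proj₂-onStar σ foldedStars) (cong (map (map σ)) folded≡)))
    where
    quarter≡ : map proj₂ quarterStars ≡ quarterLists
    quarter≡ = sym (List.map-∘ (blacks k))
    folded≡ : map proj₂ foldedStars ≡ foldedLists
    folded≡ = trans (List.map-++ proj₂ quarterStars _) (cong₂ _++_ quarter≡
      (trans (map-proj₂-onStar τ quarterStars) (cong (map (map τ)) quarter≡)))

  -- Says that the list is exactly the neighbourhood of an odd vertex in the grid. The property is
  -- verified by coordinates in the quarter only and then carried over by `τ` and `σ`.
  record IsStar (s : Star) : Set where
    field
      centre∈   : InGrid (proj₁ s)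
      odd       : par (rank (proj₁ s)) ≡ true
      unique    : Unique (proj₂ s)
      sound     : ∀ {w} → w ∈ proj₂ s → InGrid w × Adjacent (proj₁ s) w
      complete  : ∀ {w} → InGrid w → Adjacent (proj₁ s) w → w ∈ proj₂ s
  open IsStar

  rank-β : ∀ i d → rank (β (i , d)) ≡ suc ((i ℕ.+ d) ℕ.+ (i ℕ.+ d))
  rank-β i d = lemma i d
    where
    lemma : ∀ i d → i ℕ.+ suc (i ℕ.+ (d ℕ.+ d)) ≡ suc ((i ℕ.+ d) ℕ.+ (i ℕ.+ d))
    lemma = ℕS.solve-∀

  rank≤⇒InGrid : ∀ {i j} → 1 ≤ i → i ≤ j → i ℕ.+ j ≤ side → InGrid (i , j)
  rank≤⇒InGrid {i} {j} 1≤i i≤j le = (1≤i , ℕ.≤-trans i≤j j≤n) , (ℕ.≤-trans 1≤i i≤j , j≤n)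
    where
    j≤n : j ≤ n
    j≤n = ℕ.≤-pred (ℕ.≤-trans (ℕ.+-monoˡ-≤ j 1≤i) (ℕ.≤-trans le (ℕ.≤-reflexive side≡)))

  whites-InGrid : ∀ {v} → v ∈ whites k → InGrid (φ v)
  whites-InGrid {i , d} v∈ = rank≤⇒InGrid (proj₁ (∈-whites⁻ k v∈)) (ℕ.m≤m+n i _) (rank-whites v∈)

  rank-β-< : ∀ {v} → v ∈ blacks k → rank (β v) < side
  rank-β-< {i , d} v∈ = ℕ.≤-trans (s≤s (ℕ.≤-reflexive (rank-β i d))) (ℕ.≤-trans (s≤s (s≤s (ℕ.+-mono-≤ le le)))
    (ℕ.≤-reflexive (cong suc (sym (ℕ.+-suc k k)))))
    where le = proj₂ (∈-blacks⁻ k v∈)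

  blacks-InGrid : ∀ {v} → v ∈ blacks k → InGrid (β v)
  blacks-InGrid {i , d} v∈ = rank≤⇒InGrid (proj₁ (∈-blacks⁻ k v∈))
    (ℕ.≤-trans (ℕ.m≤m+n i _) (ℕ.n≤1+n _)) (ℕ.<⇒≤ (rank-β-< v∈))

  neighbours-adjacent : ∀ b → All (λ w → Adjacent (β b) (φ w)) (neighbours b)
  neighbours-adjacent (i , d) =
    inj₂ (inj₁ refl) ∷
    inj₁ (inj₁ (cong (i ,_) (lemma i d))) ∷
    inj₁ (inj₂ refl) ∷
    above i
    where
    lemma : ∀ i d → i ℕ.+ (suc d ℕ.+ suc d) ≡ suc (suc (i ℕ.+ (d ℕ.+ d)))
    lemma = ℕS.solve-∀
    above : ∀ i → All (λ w → Adjacent (β (i , d)) (φ w)) (up (i , d))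
    above zero          = []
    above (suc zero)    = []
    above (suc (suc i)) = inj₂ (inj₂ (cong (suc (suc i) ,_) (sym (lemma (suc i) d)))) ∷ []

  neighbours-complete : ∀ b {w} → InGrid w → Adjacent (β b) w → w ∈ map φ (neighbours b)
  neighbours-complete (i , d) w∈ (inj₁ (inj₁ refl)) = there (here (cong (i ,_) (lemma i d)))
    where
    lemma : ∀ i d → suc (suc (i ℕ.+ (d ℕ.+ d))) ≡ i ℕ.+ (suc d ℕ.+ suc d)
    lemma = ℕS.solve-∀
  neighbours-complete (i , d) w∈ (inj₁ (inj₂ refl)) = there (there (here refl))
  neighbours-complete (i , d) w∈ (inj₂ (inj₁ refl)) = here refl
  neighbours-complete (suc (suc i) , d) {.(suc i) , j} w∈ (inj₂ (inj₂ refl)) =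
    there (there (there (here (cong (suc i ,_) (lemma (suc i) d)))))
    where
    lemma : ∀ i d → suc (suc i ℕ.+ (d ℕ.+ d)) ≡ i ℕ.+ (suc d ℕ.+ suc d)
    lemma = ℕS.solve-∀
  neighbours-complete (suc zero , d) ((() , _) , _) (inj₂ (inj₂ refl))

  neighbours-unique : ∀ b → Unique (neighbours b)
  neighbours-unique b = All.map (λ q≻b b≡q → ≻⇒≢ q≻b (sym b≡q)) (neighbours-≻ b) ∷
    All.map (λ q≢r r≡q → q≢r (sym r≡q)) (downUp-≢-right b) ∷ tail b
    where
    tail : ∀ b → Unique (downUp b)
    tail (zero        , d) = [] ∷ []
    tail (suc zero    , d) = [] ∷ []
    tail (suc (suc i) , d) = ((λ ()) ∷ []) ∷ [] ∷ []

  quarter-IsStar : ∀ {b} → b ∈ blacks k → IsStar (β b , map φ (neighbours b))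
  quarter-IsStar {b@(i , d)} b∈ = record
    { centre∈  = blacks-InGrid b∈
    ; odd      = trans (cong par (rank-β i d)) (cong not (par-double (i ℕ.+ d)))
    ; unique   = Unique.map⁺ φ-injective (neighbours-unique b)
    ; sound    = All.lookup {P = λ w → InGrid w × Adjacent (β b) w} (All.map⁺ (All.zip (All.map whites-InGrid (neighbours⊆whites k b∈) , neighbours-adjacent b)))
    ; complete = neighbours-complete b
    }

  par-rank-τ : ∀ {v} → InBox v → par (rank (τ v)) ≡ par (rank v)
  par-rank-τ {v} v∈ = xor-false _ _ (trans (sym (par-+ (rank (τ v)) (rank v)))
    (trans (cong par (τ-rank v∈)) (par-double side)))
    where
    xor-false : ∀ a b → a xor b ≡ false → a ≡ b
    xor-false true  true  _ = refl
    xor-false false b     e = sym e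

  τ-IsStar : ∀ {s} → IsStar s → IsStar (onStar τ s)
  τ-IsStar {b , N} st = record
    { centre∈  = τ-InGrid (centre∈ st)
    ; odd      = trans (par-rank-τ b∈) (odd st)
    ; unique   = Unique-map (λ u∈ v∈ → τ-injective (box u∈) (box v∈)) (unique st)
    ; sound    = λ w∈ → snd (∈.∈-map⁻ τ w∈)
    ; complete = λ {w} w∈ adj → subst (_∈ map τ N) (τ-involutive (InGrid⇒InBox w∈)) (∈.∈-map⁺ τ
        (complete st (τ-InGrid w∈) (subst (λ u → Adjacent u (τ w)) (τ-involutive b∈)
          (adjacent-τ (InGrid⇒InBox (τ-InGrid (centre∈ st))) (InGrid⇒InBox w∈) adj))))
    }
    where
    b∈ = InGrid⇒InBox (centre∈ st)
    box : ∀ {v} → v ∈ N → InBox v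
    box v∈ = InGrid⇒InBox (proj₁ (sound st v∈))
    snd : ∀ {w} → (∃ λ v → v ∈ N × w ≡ τ v) → InGrid w × Adjacent (τ b) w
    snd (v , v∈ , refl) = τ-InGrid (proj₁ (sound st v∈)) , adjacent-τ b∈ (box v∈) (proj₂ (sound st v∈))

  σ-IsStar : ∀ {s} → IsStar s → IsStar (onStar σ s)
  σ-IsStar {(i , j) , N} st = record
    { centre∈  = proj₂ (centre∈ st) , proj₁ (centre∈ st)
    ; odd      = trans (cong par (ℕ.+-comm j i)) (odd st)
    ; unique   = Unique.map⁺ σ-injective (unique st)
    ; sound    = λ w∈ → snd (∈.∈-map⁻ σ w∈)
    ; complete = λ w∈ adj → ∈.∈-map⁺ σ (complete st (proj₂ w∈ , proj₁ w∈) (adjacent-σ adj))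
    }
    where
    snd : ∀ {w} → (∃ λ v → v ∈ N × w ≡ σ v) → InGrid w × Adjacent (j , i) w
    snd (v , v∈ , refl) = (proj₂ (proj₁ (sound st v∈)) , proj₁ (proj₁ (sound st v∈))) , adjacent-σ (proj₂ (sound st v∈))

  foldedStars-IsStar : All IsStar foldedStars
  foldedStars-IsStar = All.++⁺ quarter (All.map⁺ (All.map τ-IsStar quarter))
    where
    quarter : All IsStar quarterStars
    quarter = All.map⁺ (All.tabulate quarter-IsStar)

  allStars-IsStar : All IsStar allStars
  allStars-IsStar = All.++⁺ foldedStars-IsStar (All.map⁺ (All.map σ-IsStar foldedStars-IsStar))

  foldedBlacks : List Vertex
  foldedBlacks = map β (blacks k) ++ map (τ ∘ β) (blacks k)

  allBlacks≡ : allBlacks ≡ foldedBlacks ++ map σ foldedBlacks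
  allBlacks≡ = trans (List.map-++ proj₁ foldedStars _) (cong₂ _++_ folded≡
      (trans (map-proj₁-onStar σ foldedStars) (cong (map σ) folded≡)))
    where
    quarter≡ : map proj₁ quarterStars ≡ map β (blacks k)
    quarter≡ = sym (List.map-∘ (blacks k))
    folded≡ : map proj₁ foldedStars ≡ foldedBlacks
    folded≡ = trans (List.map-++ proj₁ quarterStars _) (cong₂ _++_ quarter≡
      (trans (map-proj₁-onStar τ quarterStars) (trans (cong (map τ) quarter≡) (sym (List.map-∘ (blacks k))))))

-- The vertices of the grid sorted by colour.

β-injective : ∀ {u v} → β u ≡ β v → u ≡ v
β-injective {i , d} {j , e} eq = φ-injective (cong₂ _,_ (cong proj₁ eq) (ℕ.suc-injective (cong proj₂ eq)))

-- `gridEdges` starts each edge at the end with the smaller coordinate sum, the stars at the black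
-- end; this passes from the second convention to the first.
orient : Edge → Edge
orient (u , v) = if (proj₁ u ℕ.+ proj₂ u) <ᵇ (proj₁ v ℕ.+ proj₂ v) then (u , v) else (v , u)

<⇒<ᵇ≡ : ∀ {m n} → m < n → (m <ᵇ n) ≡ true
<⇒<ᵇ≡ {m} {n} m<n with m <ᵇ n | ℕ.<⇒<ᵇ m<n
... | true | _ = refl

≥⇒<ᵇ≡ : ∀ {m n} → n ≤ m → (m <ᵇ n) ≡ false
≥⇒<ᵇ≡ {m} {n} n≤m with m <ᵇ n in eq
... | false = refl
... | true  = ⊥-elim (ℕ.<⇒≱ (ℕ.<ᵇ⇒< m n (subst T (sym eq) _)) n≤m)

step-rank : ∀ {u v} → Step u v → proj₁ v ℕ.+ proj₂ v ≡ suc (proj₁ u ℕ.+ proj₂ u)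
step-rank {i , j} (inj₁ refl) = ℕ.+-suc i j
step-rank         (inj₂ refl) = refl

orient-< : ∀ {u v} → Step u v → orient (u , v) ≡ (u , v)
orient-< {u} {v} s rewrite <⇒<ᵇ≡ (ℕ.≤-reflexive (sym (step-rank s))) = refl

orient-> : ∀ {u v} → Step u v → orient (v , u) ≡ (u , v)
orient-> {u} {v} s rewrite ≥⇒<ᵇ≡ (ℕ.<⇒≤ (ℕ.≤-reflexive (sym (step-rank s)))) = refl

nearPerfect-cong : ∀ {c c′} V → (∀ {v} → v ∈ V → c v ≡ c′ v) → nearPerfect V c ≡ nearPerfect V c′
nearPerfect-cong {c} {c′} V eq = cong₂ _∧_ (allᵇ-cong V eq) (cong (_≡ᵇ 1) (zeros-cong V eq))
  where
  allᵇ-cong : ∀ V → (∀ {v} → v ∈ V → c v ≡ c′ v) → allᵇ (λ v → c v ≤ᵇ 1) V ≡ allᵇ (λ v → c′ v ≤ᵇ 1) V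
  allᵇ-cong []      eq = refl
  allᵇ-cong (v ∷ V) eq = cong₂ _∧_ (cong (_≤ᵇ 1) (eq (here refl))) (allᵇ-cong V (eq ∘ there))

zeros-↭ : ∀ c {U V} → U ↭ V → zeros c U ≡ zeros c V
zeros-↭ c p = ↭.↭-length (↭.filter-↭ (λ v → T? (c v ≡ᵇ 0)) p)

nearPerfect-↭ : ∀ c {U V} → U ↭ V → ⟦ nearPerfect U c ⟧ ≡ ⟦ nearPerfect V c ⟧
nearPerfect-↭ c {U} {V} p = trans (nearPerfect-∏ U c)
  (trans (cong₂ (λ x n → x * [ n ≡1]) (∏-↭ _ p) (zeros-↭ c p)) (sym (nearPerfect-∏ V c)))

degreeIn-↭ : ∀ {M M′} v → M ↭ M′ → degreeIn M v ≡ degreeIn M′ v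
degreeIn-↭ v p = ↭.↭-length (↭.filter-↭ (λ e → T? (incident v e)) p)

-- Double counting: each entry of `l` is counted at exactly one vertex of `V`. Used for the black
-- ends and for the white ends of the same edges, it makes the two degree sums equal.
sum-count : ∀ {V} → Unique V → ∀ l → All (_∈ V) l → sum (map (λ v → count v l) V) ≡ length l
sum-count {V} u []      []        = zero-sum V
  where
  zero-sum : ∀ V → sum (map (λ v → count v []) V) ≡ 0
  zero-sum []      = refl
  zero-sum (_ ∷ V) = zero-sum V
sum-count {V} u (x ∷ l) (x∈ ∷ l⊆) = trans (add u x∈) (cong suc (sum-count u l l⊆))
  where
  skip : ∀ {V} → x ∉ V → sum (map (λ v → count v (x ∷ l)) V) ≡ sum (map (λ v → count v l) V)
  skip {[]}    x∉ = refl
  skip {v ∷ V} x∉ rewrite ≢⇒==ᵥ {v} {x} (x∉ ∘ here ∘ sym) = cong (count v l ℕ.+_) (skip (x∉ ∘ there))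
  add : ∀ {V} → Unique V → x ∈ V → sum (map (λ v → count v (x ∷ l)) V) ≡ suc (sum (map (λ v → count v l) V))
  add {v ∷ V} (v∉ ∷ u) (here refl) rewrite ==ᵥ-refl x = cong (λ s → suc (count x l ℕ.+ s)) (skip (λ x∈ → All.lookup v∉ x∈ refl))
  add {v ∷ V} (v∉ ∷ u) (there x∈) rewrite ≢⇒==ᵥ {v} {x} (λ { refl → All.lookup v∉ x∈ refl }) =
    trans (cong (count v l ℕ.+_) (add u x∈)) (ℕ.+-suc (count v l) _)

module Count (k : ℕ) where
  open Fold k
  open Reflect k
  open Grid k
  open IsStar

  rank-τβ : ∀ {v} → v ∈ blacks k → side < rank (τ (β v))
  rank-τβ {v} v∈ = ℕ.+-cancelʳ-< (rank (β v)) _ _ (ℕ.≤-trans (ℕ.+-monoʳ-< side (rank-β-< v∈))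
    (ℕ.≤-reflexive (sym (τ-rank (InGrid⇒InBox (blacks-InGrid v∈))))))

  foldedBlacks-< : ∀ {v} → v ∈ foldedBlacks → proj₁ v < proj₂ v
  foldedBlacks-< v∈ with ∈.∈-++⁻ (map β (blacks k)) v∈
  ... | inj₁ v∈β with (i , d) , _ , refl ← ∈.∈-map⁻ β v∈β = s≤s (ℕ.m≤m+n i _)
  ... | inj₂ v∈τ with (i , d) , w∈ , refl ← ∈.∈-map⁻ (τ ∘ β) v∈τ =
    ℕ.∸-monoʳ-< (s≤s (ℕ.m≤m+n i _)) (proj₂ (InGrid⇒InBox (blacks-InGrid w∈)))

  foldedBlacks-unique : Unique foldedBlacks
  foldedBlacks-unique = Unique.++⁺ (Unique.map⁺ β-injective (blacks-unique k))
    (Unique-map (λ u∈ v∈ eq → β-injective (τ-injective (InGrid⇒InBox (blacks-InGrid u∈)) (InGrid⇒InBox (blacks-InGrid v∈)) eq))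
      (blacks-unique k))
    disjoint
    where
    disjoint : ∀ {v} → ¬ (v ∈ map β (blacks k) × v ∈ map (τ ∘ β) (blacks k))
    disjoint (v∈β , v∈τ) with w , w∈ , refl ← ∈.∈-map⁻ β v∈β | w′ , w′∈ , eq ← ∈.∈-map⁻ (τ ∘ β) v∈τ =
      ℕ.<-asym (rank-β-< w∈) (subst (λ u → side < rank u) (sym eq) (rank-τβ w′∈))

  allBlacks-unique : Unique allBlacks
  allBlacks-unique = subst Unique (sym allBlacks≡) (Unique.++⁺ foldedBlacks-unique (Unique.map⁺ σ-injective foldedBlacks-unique) disjoint)
    where
    disjoint : ∀ {v} → ¬ (v ∈ foldedBlacks × v ∈ map σ foldedBlacks)
    disjoint (v∈ , v∈σ) with u , u∈ , refl ← ∈.∈-map⁻ σ v∈σ = ℕ.<-asym (foldedBlacks-< v∈) (foldedBlacks-< u∈)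

  ∈-offDiagonal⁻ : ∀ {v} → v ∈ offDiagonal → v ∈ foldedWhites × proj₁ v < proj₂ v
  ∈-offDiagonal⁻ {i , j} v∈ with v∈f , t ← ∈.∈-filter⁻ (λ v → T? (not (diagonal v))) {xs = foldedWhites} v∈ =
    v∈f , ℕ.≤∧≢⇒< (foldedWhites-≤ v∈f) (λ { refl → absurd (i ≡ᵇ i) (ℕ.≡⇒≡ᵇ i i refl) t })
    where
    absurd : ∀ b → T b → T (not b) → ⊥
    absurd true _ ()

  ∈-offDiagonal⁺ : ∀ {v} → v ∈ foldedWhites → proj₁ v ≢ proj₂ v → v ∈ offDiagonal
  ∈-offDiagonal⁺ {i , j} v∈ i≢j = ∈.∈-filter⁺ (λ v → T? (not (diagonal v))) v∈ (off (i ≡ᵇ j) (i≢j ∘ ℕ.≡ᵇ⇒≡ i j))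
    where
    off : ∀ b → ¬ T b → T (not b)
    off true  ¬t = ⊥-elim (¬t _)
    off false _  = _

  allWhites-unique : Unique allWhites
  allWhites-unique = Unique.++⁺ foldedWhites-unique
    (Unique.map⁺ σ-injective (Unique.filter⁺ (λ v → T? (not (diagonal v))) foldedWhites-unique)) disjoint
    where
    disjoint : ∀ {v} → ¬ (v ∈ foldedWhites × v ∈ map σ offDiagonal)
    disjoint (v∈ , v∈σ) with u , u∈ , refl ← ∈.∈-map⁻ σ v∈σ = ℕ.<⇒≱ (proj₂ (∈-offDiagonal⁻ u∈)) (foldedWhites-≤ v∈)

  foldedWhites-even : ∀ {v} → v ∈ foldedWhites → InGrid v × par (rank v) ≡ false
  foldedWhites-even v∈ with ∈-foldedWhites⁻ v∈
  ... | inj₁ ((i , d) , w∈ , refl) = whites-InGrid w∈ , trans (cong par (rank-φ i d)) (par-double (i ℕ.+ d))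
  ... | inj₂ ((i , d) , w∈ , refl) = τ-InGrid (whites-InGrid (blacks⊆whites w∈)) ,
    trans (par-rank-τ (whites-InBox (blacks⊆whites w∈))) (trans (cong par (rank-φ i d)) (par-double (i ℕ.+ d)))

  allWhites-even : ∀ {v} → v ∈ allWhites → InGrid v × par (rank v) ≡ false
  allWhites-even {i , j} v∈ with ∈.∈-++⁻ foldedWhites v∈
  ... | inj₁ v∈f = foldedWhites-even v∈f
  ... | inj₂ v∈σ with u , u∈ , refl ← ∈.∈-map⁻ σ v∈σ with (u₁ , u₂) , e ← foldedWhites-even (proj₁ (∈-offDiagonal⁻ u∈)) =
    (u₂ , u₁) , trans (cong par (ℕ.+-comm i j)) e

  ∈-allBlacks⁻ : ∀ {v} → v ∈ allBlacks → ∃ λ N → (v , N) ∈ allStars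
  ∈-allBlacks⁻ v∈ with (_ , N) , s∈ , refl ← ∈.∈-map⁻ proj₁ v∈ = N , s∈

  allBlacks-odd : ∀ {v} → v ∈ allBlacks → InGrid v × par (rank v) ≡ true
  allBlacks-odd v∈ with N , s∈ ← ∈-allBlacks⁻ v∈ with st ← All.lookup allStars-IsStar s∈ = centre∈ st , odd st

  -- The parity of j - i decides the colour, and its integer half is the second index.
  quarter-cover : ∀ {i j} → 1 ≤ i → i ≤ j → i ℕ.+ j ≤ side →
                  (i , j) ∈ map φ (whites k) ⊎ (i , j) ∈ map β (blacks k)
  quarter-cover {i} {j} 1≤i i≤j le with halve (j ∸ i)
  ... | d , inj₁ eq with refl ← trans (sym (ℕ.m+[n∸m]≡n i≤j)) (cong (i ℕ.+_) eq) =
    inj₁ (∈.∈-map⁺ φ (∈-whites⁺ k 1≤i (halve-≤ _ _ (ℕ.≤-trans (ℕ.≤-reflexive (sym (rank-φ i d))) le))))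
  ... | d , inj₂ eq with refl ← trans (sym (ℕ.m+[n∸m]≡n i≤j)) (trans (cong (i ℕ.+_) eq) (ℕ.+-suc i (d ℕ.+ d))) =
    inj₂ (∈.∈-map⁺ β (∈-blacks⁺ k 1≤i (ℕ.≤-pred (lt (ℕ.≤-trans (ℕ.≤-reflexive (sym (rank-β i d))) le)))))
    where
    lt : suc ((i ℕ.+ d) ℕ.+ (i ℕ.+ d)) ≤ side → i ℕ.+ d < suc k
    lt le with i ℕ.+ d ℕ.<? suc k
    ... | yes p = p
    ... | no ¬p = ⊥-elim (ℕ.<⇒≱ le (ℕ.+-mono-≤ (ℕ.≮⇒≥ ¬p) (ℕ.≮⇒≥ ¬p)))

  -- A vertex beyond the other diagonal is reflected into the quarter, located there, and reflected
  -- back.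
  folded-cover : ∀ {v} → InGrid v → proj₁ v ≤ proj₂ v → v ∈ foldedWhites ⊎ v ∈ foldedBlacks
  folded-cover {v@(i , j)} v∈@((1≤i , _) , (1≤j , _)) i≤j with ℕ.≤-total (rank v) side
  ... | inj₁ le with quarter-cover 1≤i i≤j le
  ...   | inj₁ v∈φ with w , w∈ , eq ← ∈.∈-map⁻ φ v∈φ = inj₁ (subst (_∈ foldedWhites) (sym eq) (φ∈foldedWhites w∈))
  ...   | inj₂ v∈β = inj₂ (∈.∈-++⁺ˡ v∈β)
  folded-cover {v@(i , j)} v∈ i≤j | inj₂ ge
    with quarter-cover (proj₁ (proj₁ (τ-InGrid v∈))) (ℕ.∸-monoʳ-≤ side i≤j)
           (ℕ.+-cancelʳ-≤ (rank v) _ side (ℕ.≤-trans (ℕ.≤-reflexive (τ-rank (InGrid⇒InBox v∈))) (ℕ.+-monoʳ-≤ side ge)))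
  ...   | inj₁ v∈φ with w , w∈ , eq ← ∈.∈-map⁻ φ v∈φ =
    inj₁ (subst (_∈ foldedWhites) (trans (cong τ (sym eq)) (τ-involutive (InGrid⇒InBox v∈))) (τφ∈foldedWhites w∈))
  ...   | inj₂ v∈β with w , w∈ , eq ← ∈.∈-map⁻ β v∈β =
    inj₂ (subst (_∈ foldedBlacks) (trans (cong τ (sym eq)) (τ-involutive (InGrid⇒InBox v∈)))
      (∈.∈-++⁺ʳ (map β (blacks k)) (∈.∈-map⁺ (τ ∘ β) w∈)))

  cover : ∀ {v} → InGrid v → v ∈ allBlacks ⊎ v ∈ allWhites
  cover {v@(i , j)} v∈ rewrite allBlacks≡ with i ℕ.≤? j
  ... | yes i≤j with folded-cover v∈ i≤j
  ...   | inj₁ v∈w = inj₂ (∈.∈-++⁺ˡ v∈w)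
  ...   | inj₂ v∈b = inj₁ (∈.∈-++⁺ˡ v∈b)
  cover {v@(i , j)} (i∈ , j∈) | no i≰j with folded-cover (j∈ , i∈) (ℕ.<⇒≤ (ℕ.≰⇒> i≰j))
  ...   | inj₁ v∈w = inj₂ (∈.∈-++⁺ʳ foldedWhites (∈.∈-map⁺ σ (∈-offDiagonal⁺ v∈w (ℕ.<⇒≢ (ℕ.≰⇒> i≰j)))))
  ...   | inj₂ v∈b = inj₁ (∈.∈-++⁺ʳ foldedBlacks (∈.∈-map⁺ σ v∈b))

  even≢odd : ∀ {u v} → par (rank u) ≡ false → par (rank v) ≡ true → u ≢ v
  even≢odd e o refl with () ← trans (sym e) o

  vertices : List Vertex
  vertices = gridVertices n n

  vertices≡ : vertices ≡ cartesianProduct (range n) (range n)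
  vertices≡ = concatMap-map _,_ (range n) (range n)

  ∈-vertices⁻ : ∀ {v} → v ∈ vertices → InGrid v
  ∈-vertices⁻ v∈ rewrite vertices≡ with i∈ , j∈ ← ∈.∈-cartesianProduct⁻ (range n) (range n) v∈ = ∈-range⁻ i∈ , ∈-range⁻ j∈

  ∈-vertices⁺ : ∀ {v} → InGrid v → v ∈ vertices
  ∈-vertices⁺ ((1≤i , i≤n) , (1≤j , j≤n)) rewrite vertices≡ = ∈.∈-cartesianProduct⁺ (∈-range⁺ 1≤i i≤n) (∈-range⁺ 1≤j j≤n)

  vertices-↭ : vertices ↭ allBlacks ++ allWhites
  vertices-↭ = Unique⇒↭ (subst Unique (sym vertices≡) (Unique.cartesianProduct⁺ (range-unique n) (range-unique n)))
    (Unique.++⁺ allBlacks-unique allWhites-unique (λ {v} (b∈ , w∈) → even≢odd {v} {v} (proj₂ (allWhites-even w∈)) (proj₂ (allBlacks-odd b∈)) refl))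
    (λ v∈ → split (cover (∈-vertices⁻ v∈)))
    (λ v∈ → ∈-vertices⁺ (grid (∈.∈-++⁻ allBlacks v∈)))
    where
    split : ∀ {v} → v ∈ allBlacks ⊎ v ∈ allWhites → v ∈ allBlacks ++ allWhites
    split (inj₁ b∈) = ∈.∈-++⁺ˡ b∈
    split (inj₂ w∈) = ∈.∈-++⁺ʳ allBlacks w∈
    grid : ∀ {v} → v ∈ allBlacks ⊎ v ∈ allWhites → InGrid v
    grid (inj₁ b∈) = proj₁ (allBlacks-odd b∈)
    grid (inj₂ w∈) = proj₁ (allWhites-even w∈)

incident-orient : ∀ v b w → incident v (orient (b , w)) ≡ ((v ==ᵥ b) ∨ (v ==ᵥ w))
incident-orient v b@(i , j) w@(i′ , j′) with (i ℕ.+ j) <ᵇ (i′ ℕ.+ j′)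
... | true  = refl
... | false = Bool.∨-comm (v ==ᵥ w) (v ==ᵥ b)

length-filterᵇ-map : {p : B → Bool} {q : A → Bool} {g : A → B} (xs : List A) → (∀ {x} → x ∈ xs → p (g x) ≡ q x) →
                     length (filterᵇ p (map g xs)) ≡ length (filterᵇ q xs)
length-filterᵇ-map         []       eq = refl
length-filterᵇ-map {q = q} (x ∷ xs) eq rewrite eq {x} (here refl) with q x
... | true  = cong suc (length-filterᵇ-map xs (eq ∘ there))
... | false = length-filterᵇ-map xs (eq ∘ there)

degree-orient : ∀ (π : Edge → Vertex) v P → All (λ e → incident v (orient e) ≡ (v ==ᵥ π e)) P →
                degreeIn (map orient P) v ≡ count v (map π P)
degree-orient π v P h = trans (length-filterᵇ-map P (All.lookup h)) (sym (length-filterᵇ-map P (λ _ → refl)))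

length-filterᵇ-++ : (p : A → Bool) (xs ys : List A) →
                    length (filterᵇ p (xs ++ ys)) ≡ length (filterᵇ p xs) ℕ.+ length (filterᵇ p ys)
length-filterᵇ-++ p xs ys = trans (cong length (List.filter-++ (T? ∘ p) xs ys)) (List.length-++ (filterᵇ p xs))

length-filterᵇ-all : (p : A → Bool) (xs : List A) → (∀ {x} → x ∈ xs → p x ≡ true) → length (filterᵇ p xs) ≡ length xs
length-filterᵇ-all p []       h = refl
length-filterᵇ-all p (x ∷ xs) h rewrite h {x} (here refl) = cong suc (length-filterᵇ-all p xs (h ∘ there))

-- Counting vertices off the main diagonal.

off : Vertex → Bool
off = not ∘ onDiagonal

length-column : ∀ m d → length (column m d) ≡ m
length-column zero    d = refl
length-column (suc m) d = cong suc (length-column m d)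

length-outer : ∀ m d → length (outer m d) ≡ suc m
length-outer zero    d = refl
length-outer (suc m) d = cong suc (length-outer m (suc d))

off-column : ∀ m → length (filterᵇ off (column m 0)) ≡ 0
off-column zero    = refl
off-column (suc m) = off-column m

-- Read as white indices, the k entries with d = 0, one for each i from 1 to k, lie on the main
-- diagonal.
off-blacks : ∀ k → length (filterᵇ off (blacks k)) ℕ.+ k ≡ length (blacks k)
off-blacks zero    = refl
off-blacks (suc m) = begin
  length (filterᵇ off (t ++ column (suc m) 0)) ℕ.+ suc m
    ≡⟨ cong (ℕ._+ suc m) (length-filterᵇ-++ off t (column (suc m) 0)) ⟩
  length (filterᵇ off t) ℕ.+ length (filterᵇ off (column m 0)) ℕ.+ suc m
    ≡⟨ cong₂ (λ x y → x ℕ.+ y ℕ.+ suc m) (length-filterᵇ-all off t off-t) (off-column m) ⟩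
  length t ℕ.+ 0 ℕ.+ suc m
    ≡⟨ cong₂ ℕ._+_ (ℕ.+-identityʳ (length t)) (sym (length-column (suc m) 0)) ⟩
  length t ℕ.+ length (column (suc m) 0)
    ≡⟨ List.length-++ t ⟨
  length (t ++ column (suc m) 0) ∎
  where
  open ≡-Reasoning
  t = triangle m 1
  off-t : ∀ {v} → v ∈ t → off v ≡ true
  off-t {i , zero}  v∈ with _ , () , _ ← ∈-triangle⁻ {m} v∈
  off-t {i , suc d} v∈ = refl

off-outer : ∀ k → length (filterᵇ off (outer k 0)) ≡ k
off-outer zero    = refl
off-outer (suc m) = trans (length-filterᵇ-all off (outer m 1) off-t) (length-outer m 1)
  where
  off-t : ∀ {v} → v ∈ outer m 1 → off v ≡ true
  off-t {i , zero}  v∈ with _ , () , _ ← ∈-outer⁻ {m} v∈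
  off-t {i , suc d} v∈ = refl

-- The number of matchings as a power of 2 times the folded sum.

module Divisibility (k : ℕ) where
  open Fold k
  open Reflect k
  open Grid k
  open Count k
  open IsStar
  open Weight using (W)

  edges : List Edge
  edges = gridEdges n n

  horizontal vertical : ℕ → ℕ → Edge
  horizontal i j = (i , j) , (i , suc j)
  vertical   i j = (i , j) , (suc i , j)

  edges≡ : edges ≡ cartesianProductWith horizontal (range n) (range (2 ℕ.* k)) ++
                   cartesianProductWith vertical (range (2 ℕ.* k)) (range n)
  edges≡ = cong₂ _++_ (concatMap-map horizontal (range n) (range (2 ℕ.* k)))
                      (concatMap-map vertical (range (2 ℕ.* k)) (range n))

  ∈-edges⁻ : ∀ {u v} → (u , v) ∈ edges → InGrid u × InGrid v × Step u v
  ∈-edges⁻ e∈ rewrite edges≡ with ∈.∈-++⁻ (cartesianProductWith horizontal (range n) (range (2 ℕ.* k))) e∈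
  ... | inj₁ e∈h with i , j , i∈ , j∈ , refl ← ∈.∈-cartesianProductWith⁻ horizontal (range n) (range (2 ℕ.* k)) e∈h =
    (∈-range⁻ i∈ , proj₁ (∈-range⁻ j∈) , ℕ.m≤n⇒m≤1+n (proj₂ (∈-range⁻ j∈))) ,
    (∈-range⁻ i∈ , s≤s z≤n , s≤s (proj₂ (∈-range⁻ j∈))) , inj₁ refl
  ... | inj₂ e∈v with i , j , i∈ , j∈ , refl ← ∈.∈-cartesianProductWith⁻ vertical (range (2 ℕ.* k)) (range n) e∈v =
    ((proj₁ (∈-range⁻ i∈) , ℕ.m≤n⇒m≤1+n (proj₂ (∈-range⁻ i∈))) , ∈-range⁻ j∈) ,
    ((s≤s z≤n , s≤s (proj₂ (∈-range⁻ i∈))) , ∈-range⁻ j∈) , inj₂ refl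

  ∈-edges⁺ : ∀ {u v} → InGrid u → InGrid v → Step u v → (u , v) ∈ edges
  ∈-edges⁺ ((1≤i , i≤n) , (1≤j , _)) (_ , (_ , s≤s j≤)) (inj₁ refl) rewrite edges≡ =
    ∈.∈-++⁺ˡ (∈.∈-cartesianProductWith⁺ horizontal (∈-range⁺ 1≤i i≤n) (∈-range⁺ 1≤j j≤))
  ∈-edges⁺ ((1≤i , _) , (1≤j , j≤n)) ((_ , s≤s i≤) , _) (inj₂ refl) rewrite edges≡ =
    ∈.∈-++⁺ʳ (cartesianProductWith horizontal (range n) (range (2 ℕ.* k)))
      (∈.∈-cartesianProductWith⁺ vertical (∈-range⁺ 1≤i i≤) (∈-range⁺ 1≤j j≤n))

  edges-unique : Unique edges
  edges-unique = subst Unique (sym edges≡) (Unique.++⁺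
    (Unique.cartesianProductWith⁺ horizontal (λ { refl → refl , refl }) (range-unique n) (range-unique (2 ℕ.* k)))
    (Unique.cartesianProductWith⁺ vertical (λ { refl → refl , refl }) (range-unique (2 ℕ.* k)) (range-unique n))
    disjoint)
    where
    disjoint : ∀ {e} → ¬ (e ∈ cartesianProductWith horizontal (range n) (range (2 ℕ.* k)) ×
                          e ∈ cartesianProductWith vertical (range (2 ℕ.* k)) (range n))
    disjoint (e∈h , e∈v)
      with i , j , _ , _ , refl ← ∈.∈-cartesianProductWith⁻ horizontal (range n) (range (2 ℕ.* k)) e∈h
      with _ , _ , _ , _ , () ← ∈.∈-cartesianProductWith⁻ vertical (range (2 ℕ.* k)) (range n) e∈v

  step-par : ∀ {u v} → Step u v → par (rank v) ≡ not (par (rank u))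
  step-par {u} {v} s = cong par (step-rank {u} {v} s)

  adjacent-par : ∀ {u v} → Adjacent u v → par (rank u) ≡ true → par (rank v) ≡ false
  adjacent-par {u} {v} (inj₁ s) odd = trans (step-par {u} {v} s) (cong not odd)
  adjacent-par {u} {v} (inj₂ s) odd with par (rank v) | trans (sym odd) (step-par {v} {u} s)
  ... | false | _ = refl

  odd⇒black : ∀ {v} → InGrid v → par (rank v) ≡ true → v ∈ allBlacks
  odd⇒black {v} v∈ odd with cover v∈
  ... | inj₁ b∈ = b∈
  ... | inj₂ w∈ = ⊥-elim (even≢odd {v} {v} (proj₂ (allWhites-even w∈)) odd refl)

  even⇒white : ∀ {v} → InGrid v → par (rank v) ≡ false → v ∈ allWhites
  even⇒white {v} v∈ even with cover v∈
  ... | inj₁ b∈ = ⊥-elim (even≢odd {v} {v} even (proj₂ (allBlacks-odd b∈)) refl)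
  ... | inj₂ w∈ = w∈

  Bicoloured : Edge → Set
  Bicoloured (b , w) = b ∈ allBlacks × w ∈ allWhites

  starEdges : List Edge
  starEdges = concatMap edgesOf allStars

  starEdges-spec : All (λ (b , w) → Bicoloured (b , w) × InGrid w × Adjacent b w) starEdges
  starEdges-spec = edgesOf-All spec
    where
    spec : ∀ {b N w} → (b , N) ∈ allStars → w ∈ N → Bicoloured (b , w) × InGrid w × Adjacent b w
    spec s∈ w∈N with st ← All.lookup allStars-IsStar s∈ with w∈ , adj ← sound st w∈N =
      (∈.∈-map⁺ proj₁ s∈ , even⇒white w∈ (adjacent-par adj (odd st))) , w∈ , adj

  unorient : Edge → Edge
  unorient (u , v) = if par (rank u) then (u , v) else (v , u)

  unorient-orient : ∀ {b w} → Bicoloured (b , w) → unorient (orient (b , w)) ≡ (b , w)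
  unorient-orient {b} {w} (b∈ , w∈) with rank b <ᵇ rank w
  ... | true  rewrite proj₂ (allBlacks-odd b∈)  = refl
  ... | false rewrite proj₂ (allWhites-even w∈) = refl

  -- Every edge has exactly one black end, which `unorient` recovers by parity; hence `orient` is
  -- injective on star edges, and both lists enumerate the same edges without repetition.
  edges-↭ : edges ↭ map orient starEdges
  edges-↭ = Unique⇒↭ edges-unique
    (Unique-map (λ p∈ q∈ eq → trans (sym (unorient-orient (bicoloured p∈))) (trans (cong unorient eq) (unorient-orient (bicoloured q∈))))
      (edgesOf-unique allBlacks-unique (All.map unique allStars-IsStar)))
    (λ e∈ → to (∈-edges⁻ e∈))
    (λ e∈ → from (∈.∈-map⁻ orient e∈))
    where
    bicoloured : ∀ {p} → p ∈ starEdges → Bicoloured p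
    bicoloured p∈ = proj₁ (All.lookup starEdges-spec p∈)
    inStar : ∀ {b w} → InGrid b → par (rank b) ≡ true → InGrid w → Adjacent b w → (b , w) ∈ starEdges
    inStar b∈ odd w∈ adj with N , s∈ ← ∈-allBlacks⁻ (odd⇒black b∈ odd) =
      ∈-edgesOf⁺ s∈ (complete (All.lookup allStars-IsStar s∈) w∈ adj)
    to : ∀ {u v} → InGrid u × InGrid v × Step u v → (u , v) ∈ map orient starEdges
    to {u} {v} (u∈ , v∈ , s) with par (rank u) in eq
    ... | true  = subst (_∈ map orient starEdges) (orient-< s) (∈.∈-map⁺ orient (inStar u∈ eq v∈ (inj₁ s)))
    ... | false = subst (_∈ map orient starEdges) (orient-> s)
      (∈.∈-map⁺ orient (inStar v∈ (trans (step-par {u} {v} s) (cong not eq)) u∈ (inj₂ s)))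
    from : ∀ {e} → (∃ λ p → p ∈ starEdges × e ≡ orient p) → e ∈ edges
    from ((b , w) , p∈ , refl) with All.lookup starEdges-spec p∈
    ... | (b∈ , _) , w∈ , inj₁ s rewrite orient-< s = ∈-edges⁺ (proj₁ (allBlacks-odd b∈)) w∈ s
    ... | (b∈ , _) , w∈ , inj₂ s rewrite orient-> s = ∈-edges⁺ w∈ (proj₁ (allBlacks-odd b∈)) s

  length-foldedLists : length foldedLists ≡ length (blacks k) ℕ.+ length (blacks k)
  length-foldedLists = trans (List.length-++ quarterLists) (cong₂ ℕ._+_ q (trans (List.length-map (map τ) quarterLists) q))
    where
    q : length quarterLists ≡ length (blacks k)
    q = List.length-map _ (blacks k)

  -- The source of the exponent k. The outer line contributes k off-diagonal vertices once, and each
  -- of the two copies of `blacks k` loses k vertices to the main diagonal.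
  length-offDiagonal : length offDiagonal ℕ.+ k ≡ length (blacks k) ℕ.+ length (blacks k)
  length-offDiagonal = begin
    length offDiagonal ℕ.+ k
      ≡⟨ cong (ℕ._+ k) (trans (length-filterᵇ-++ p (map φ (outer k 0)) _)
           (cong₂ ℕ._+_ (trans (length-filterᵇ-map (outer k 0) (λ {v} _ → cong not (onDiagonal-φ v))) (off-outer k))
             (trans (length-filterᵇ-++ p (map φ (blacks k)) _) (cong₂ ℕ._+_
               (length-filterᵇ-map (blacks k) (λ {v} _ → cong not (onDiagonal-φ v)))
               (length-filterᵇ-map (blacks k) (λ {v} v∈ → cong not
                 (trans (diagonal-τ (whites-InBox (blacks⊆whites v∈))) (onDiagonal-φ v)))))))) ⟩
    k ℕ.+ (o ℕ.+ o) ℕ.+ k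
      ≡⟨ lemma k o ⟩
    (o ℕ.+ k) ℕ.+ (o ℕ.+ k)
      ≡⟨ cong (λ b → b ℕ.+ b) (off-blacks k) ⟩
    length (blacks k) ℕ.+ length (blacks k) ∎
    where
    open ≡-Reasoning
    p = not ∘ diagonal
    o = length (filterᵇ off (blacks k))
    lemma : ∀ k o → k ℕ.+ (o ℕ.+ o) ℕ.+ k ≡ (o ℕ.+ k) ℕ.+ (o ℕ.+ k)
    lemma = ℕS.solve-∀

  length-allWhites : length allWhites ≡ suc (length allBlacks)
  length-allWhites = begin
    length allWhites
      ≡⟨ trans (List.length-++ foldedWhites) (cong₂ ℕ._+_
           (trans (List.length-++ (map φ (outer k 0))) (cong₂ ℕ._+_ (trans (List.length-map φ (outer k 0)) (length-outer k 0))
             (trans (List.length-++ (map φ (blacks k))) (cong₂ ℕ._+_ (List.length-map φ (blacks k)) (List.length-map (τ ∘ φ) (blacks k))))))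
           (List.length-map σ offDiagonal)) ⟩
    suc k ℕ.+ (b ℕ.+ b) ℕ.+ length offDiagonal
      ≡⟨ lemma k (b ℕ.+ b) (length offDiagonal) ⟩
    suc ((b ℕ.+ b) ℕ.+ (length offDiagonal ℕ.+ k))
      ≡⟨ cong (λ m → suc ((b ℕ.+ b) ℕ.+ m)) length-offDiagonal ⟩
    suc ((b ℕ.+ b) ℕ.+ (b ℕ.+ b))
      ≡⟨ cong suc (trans (cong length allBlacks≡) (trans (List.length-++ foldedBlacks)
           (cong₂ ℕ._+_ folded (trans (List.length-map σ foldedBlacks) folded)))) ⟨
    suc (length allBlacks) ∎
    where
    open ≡-Reasoning
    b = length (blacks k)
    lemma : ∀ k b o → suc k ℕ.+ b ℕ.+ o ≡ suc (b ℕ.+ (o ℕ.+ k))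
    lemma = ℕS.solve-∀
    folded : length foldedBlacks ≡ b ℕ.+ b
    folded = trans (List.length-++ (map β (blacks k))) (cong₂ ℕ._+_ (List.length-map β (blacks k)) (List.length-map (τ ∘ β) (blacks k)))

  -- As the edges are bicoloured, a black vertex can occur only as a first end and a white one only
  -- as a second end, so degrees become counts in the two projections.
  nearPerfect-starEdges : ∀ P → All Bicoloured P →
    ⟦ isNearPerfectMatching vertices (map orient P) ⟧ ≡
    ∏ allBlacks (λ b → [ count b (map proj₁ P) ≡1]) * weight₁ allWhites (map proj₂ P)
  nearPerfect-starEdges P good = begin
    ⟦ nearPerfect vertices c ⟧
      ≡⟨ nearPerfect-↭ c vertices-↭ ⟩
    ⟦ nearPerfect (allBlacks ++ allWhites) c ⟧
      ≡⟨ nearPerfect-bipartite c allBlacks allWhites length-allWhites (trans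
           (degrees proj₁ allBlacks-unique black (All.map proj₁ good))
           (sym (degrees proj₂ allWhites-unique white (All.map proj₂ good)))) ⟩
    ∏ allBlacks (λ b → [ c b ≡1]) * ∏ allWhites (λ w → [ c w ≤1])
      ≡⟨ cong₂ _*_ (∏-cong allBlacks (λ b∈ → cong [_≡1] (black b∈))) (∏-cong allWhites (λ w∈ → cong [_≤1] (white w∈))) ⟩
    ∏ allBlacks (λ b → [ count b (map proj₁ P) ≡1]) * weight₁ allWhites (map proj₂ P) ∎
    where
    open ≡-Reasoning
    c = degreeIn (map orient P)
    black : ∀ {v} → v ∈ allBlacks → c v ≡ count v (map proj₁ P)
    black {v} v∈ = degree-orient proj₁ v P (All.map (λ {(b , w)} (_ , w∈) → trans (incident-orient v b w)
      (trans (cong ((v ==ᵥ b) ∨_) (≢⇒==ᵥ {v} {w} (λ eq → even≢odd {w} {v} (proj₂ (allWhites-even w∈)) (proj₂ (allBlacks-odd v∈)) (sym eq))))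
        (Bool.∨-identityʳ _))) good)
    white : ∀ {v} → v ∈ allWhites → c v ≡ count v (map proj₂ P)
    white {v} v∈ = degree-orient proj₂ v P (All.map (λ {(b , w)} (b∈ , _) → trans (incident-orient v b w)
      (cong (_∨ (v ==ᵥ w)) (≢⇒==ᵥ {v} {b} (even≢odd {v} {b} (proj₂ (allWhites-even v∈)) (proj₂ (allBlacks-odd b∈)))))) good)
    degrees : ∀ (π : Edge → Vertex) {V} → Unique V → (∀ {v} → v ∈ V → c v ≡ count v (map π P)) → All ((_∈ V) ∘ π) P →
              sum (map c V) ≡ length P
    degrees π u eq π∈ = trans (cong sum (List.map-cong-local (All.tabulate eq)))
      (trans (sum-count u (map π P) (All.map⁺ π∈)) (List.length-map π P))

  a≡S : ℤ.+ a n ≡ S (map (map [_]) allLists) (weight₁ allWhites)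
  a≡S = begin
    ℤ.+ a n
      ≡⟨ trans (length-filterᵇ (isNearPerfectMatching vertices) (subsets edges)) (∑-subsets edges) ⟩
    S (map include edges) w
      ≡⟨ S-↭ (λ p → cong ⟦_⟧ (nearPerfect-cong vertices (λ {v} _ → degreeIn-↭ v p))) (↭.map⁺ include edges-↭) ⟩
    S (map include (map orient starEdges)) w
      ≡⟨ trans (cong (λ Cs → S Cs w) (trans (sym (List.map-∘ starEdges)) (List.map-∘ starEdges))) (S-map orient (map include starEdges)) ⟩
    S (map include starEdges) (w ∘ map orient)
      ≡⟨ S-cong-All (include-All (All.map proj₁ starEdges-spec)) nearPerfect-starEdges ⟩
    S (map include starEdges) (λ P → ∏ allBlacks (λ b → [ count b (map proj₁ P) ≡1]) * weight₁ allWhites (map proj₂ P))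
      ≡⟨ S-stars allBlacks-unique (weight₁ allWhites) ⟩
    S (map (map [_] ∘ proj₂) allStars) (weight₁ allWhites)
      ≡⟨ cong (λ Cs → S Cs (weight₁ allWhites)) (trans (List.map-∘ allStars) (cong (map (map [_])) lists≡)) ⟩
    S (map (map [_]) allLists) (weight₁ allWhites) ∎
    where
    open ≡-Reasoning
    w : List Edge → ℤ
    w = ⟦_⟧ ∘ isNearPerfectMatching vertices

  folded : ℤ
  folded = S (map choices foldedLists) (W diagonal foldedWhites)

  power : ∀ m → (ℤ.+ 2) ℤ.^ m ≡ ℤ.+ (2 ℕ.^ m)
  power zero    = refl
  power (suc m) = trans (cong (ℤ.+ 2 *_) (power m)) (sym (ℤ.pos-* 2 (2 ℕ.^ m)))

  -- The powers of 2 from the doubled weights and from the change of labels have exponents `o` and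
  -- `o + k`; cancelling the former leaves 2^k.
  a≡2^k*folded : ℤ.+ a n ≡ ℤ.+ (2 ℕ.^ k) * folded
  a≡2^k*folded = ℤ.*-cancelˡ-≡ (ℤ.+ (2 ℕ.^ o)) (ℤ.+ a n) (ℤ.+ (2 ℕ.^ k) * folded) {{ℕ.m^n≢0 2 o}} (begin
    ℤ.+ (2 ℕ.^ o) * ℤ.+ a n
      ≡⟨ cong₂ _*_ (sym (power o)) a≡S ⟩
    (ℤ.+ 2) ℤ.^ o * S (map (map [_]) allLists) (weight₁ allWhites)
      ≡⟨ S-fold ⟩
    (ℤ.+ 2) ℤ.^ length foldedLists * folded
      ≡⟨ cong (λ m → (ℤ.+ 2) ℤ.^ m * folded) (trans length-foldedLists (sym length-offDiagonal)) ⟩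
    (ℤ.+ 2) ℤ.^ (o ℕ.+ k) * folded
      ≡⟨ cong (_* folded) (trans (power (o ℕ.+ k)) (trans (cong ℤ.+_ (ℕ.^-distribˡ-+-* 2 o k)) (ℤ.pos-* (2 ℕ.^ o) (2 ℕ.^ k)))) ⟩
    ℤ.+ (2 ℕ.^ o) * ℤ.+ (2 ℕ.^ k) * folded
      ≡⟨ ℤ.*-assoc (ℤ.+ (2 ℕ.^ o)) (ℤ.+ (2 ℕ.^ k)) folded ⟩
    ℤ.+ (2 ℕ.^ o) * (ℤ.+ (2 ℕ.^ k) * folded) ∎)
    where
    open ≡-Reasoning
    o = length offDiagonal

≈₂1⇒Odd : ∀ {x} → x ≈₂ 1ℤ → Odd ℤ.∣ x ∣
≈₂1⇒Odd (half {ℤ.+ m} refl)      = m , cong (λ t → suc (m ℕ.+ t)) (sym (ℕ.+-identityʳ m))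
-- Here h = -(m + 1), so 1 + 2h = -(2m + 1), and the witness is again `m`.
≈₂1⇒Odd (half {ℤ.-[1+ m ]} refl) = m , cong (λ t → suc (m ℕ.+ t)) (sym (ℕ.+-identityʳ m))

theorem2 : (k : ℕ) → ∃ λ c → a (suc (2 ℕ.* k)) ≡ 2 ℕ.^ k ℕ.* c × Odd c
-- `folded` is a sum of signed weights. Taking absolute values in the integer identity gives a
-- natural cofactor and preserves its parity.
theorem2 k = ℤ.∣ folded ∣ ,
  trans (cong ℤ.∣_∣ a≡2^k*folded) (ℤ.abs-* (ℤ.+ (2 ℕ.^ k)) folded) ,
  ≈₂1⇒Odd S-folded-odd
  where
  open Divisibility k
  open Fold k
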